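{- Let $k_1,k_2,k_3\in\mathbb{Z}_{\ge0}$ and let $(P,Q,R)$ be a $(k_1,k_2,k_3)$-CGC triple associated with the non-labeled cluster $(a,b,c)$ such that $|b|>\max\{|a|,|c|\}$. Then there exists a unique Markov-monodromy decomposition $(X,Y,Z)$ of $(P,Q,R)$.
   Context: Fix $k_1,k_2,k_3\in\mathbb{Z}_{\ge0}$, indeterminates $x_1,x_2,x_3$. Mutations: $\mu_1(a,b,c)=(\frac{b^2+k_1bc+c^2}{a},b,c)$, $\mu_2(a,b,c)=(a,\frac{a^2+k_2ac+c^2}{b},c)$, $\mu_3(a,b,c)=(a,b,\frac{a^2+k_3ab+b^2}{c})$. Labeled clusters of $\mathcal{A}(k_1,k_2,k_3)$: triples obtained from $(x_1,x_2,x_3)$ by finitely many mutations; non-labeled clusters: permutations of labeled clusters; cluster variables: their entries; a cluster variable $y$ occurs in a unique position $i$ among labeled clusters, and its parity is $k_y:=k_i$. $|a|$ is the value of a Laurent polynomial $a$ at $x_1=x_2=x_3=1$. $\mathscr{M}=\frac{x_1^2+x_2^2+x_3^2+k_1x_2x_3+k_2x_1x_3+k_3x_1x_2}{x_1x_2x_3}$, $T=\begin{bmatrix}-1&0\\ \mathscr{M}&-1\end{bmatrix}$, and for a $2\times2$ matrix $P=(p_{ij})$, $S_P=\begin{bmatrix}\mathscr{M}p_{12}-\mathrm{tr}P&0\\(\mathscr{M}p_{12}-\mathrm{tr}P)\mathscr{M}&\mathscr{M}p_{12}-\mathrm{tr}P\end{bmatrix}$. A CGC matrix is $P\in SL(2,\mathbb{Z}[x_1^{\pm1},x_2^{\pm1},x_3^{\pm1}])$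 with $(1,2)$-entry $p_{12}$ a cluster variable and $\mathrm{tr}P=\mathscr{M}p_{12}-k_{p_{12}}$; a CGC triple is a triple $(P,Q,R)$ of CGC matrices with $Q=PR-S_Q$ and $(p_{12},q_{12},r_{12})$ a non-labeled cluster (associated cluster). A CMM matrix is $X\in SL(2,\mathbb{Z}[x_1^{\pm1},x_2^{\pm1},x_3^{\pm1}])$ with $(1,2)$-entry $x_{12}$ a cluster variable and $\mathrm{tr}X=-k_{x_{12}}$; a CMM triple is a triple $(X,Y,Z)$ of CMM matrices with $XYZ=T$ and $(x_{12},y_{12},z_{12})$ a non-labeled cluster. A Markov-monodromy decomposition of a CGC triple $(P,Q,R)$ associated with $(a,b,c)$ is a triple $(X,Y,Z)$ such that (1) $(X,Y,Z)$ is a CMM triple; (2) $P=-(YZ)^{ -1}$, $Q=-(XZ)^{ -1}$, $R=-(XY)^{ -1}$; (3) $\mathrm{tr}X=-k_a$, $\mathrm{tr}Y=-k_b$, $\mathrm{tr}Z=-k_c$. -}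

module Defs where

open import Data.Nat using (ℕ)
open import Data.Integer as ℤ using (ℤ; +_; -[1+_])
open import Data.Bool using (Bool; _∧_; if_then_else_)
open import Data.List using (List; []; _∷_; _++_; map; concatMap; foldr)
open import Data.Product using (_×_; _,_; Σ; ∃; ∃-syntax)
open import Data.Sum using (_⊎_)
open import Relation.Nullary.Decidable using (⌊_⌋)
open import Relation.Binary.PropositionalEquality using (_≡_)

-- The Laurent polynomial ring ℤ[x₁^{±1}, x₂^{±1}, x₃^{±1}]
-- represented as finite formal sums of terms c·x₁^e₁ x₂^e₂ x₃^e₃,
-- with equality "all coefficients agree" (a setoid).

record Mono : Set where
  constructor mono
  field
    e₁ e₂ e₃ : ℤ

sameMono : Mono → Mono → Bool
sameMono (mono a b c) (mono a' b' c') =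
  ⌊ a ℤ.≟ a' ⌋ ∧ ⌊ b ℤ.≟ b' ⌋ ∧ ⌊ c ℤ.≟ c' ⌋

monoMul : Mono → Mono → Mono
monoMul (mono a b c) (mono a' b' c') = mono (a ℤ.+ a') (b ℤ.+ b') (c ℤ.+ c')

Laurent : Set
Laurent = List (ℤ × Mono)

coeff : Laurent → Mono → ℤ
coeff [] m = + 0
coeff ((c , m') ∷ p) m = if sameMono m' m then c ℤ.+ coeff p m else coeff p m

infix 4 _≈_
_≈_ : Laurent → Laurent → Set
p ≈ q = ∀ m → coeff p m ≡ coeff q m

infixl 6 _+_ _-_
infixl 7 _*_

_+_ : Laurent → Laurent → Laurent
p + q = p ++ q

-_ : Laurent → Laurent
- p = map (λ { (c , m) → (ℤ.- c , m) }) p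

_-_ : Laurent → Laurent → Laurent
p - q = p + (- q)

_*_ : Laurent → Laurent → Laurent
p * q = concatMap (λ { (c , m) → map (λ { (d , n) → (c ℤ.* d , monoMul m n) }) q }) p

zeroL : Laurent
zeroL = []

cst : ℤ → Laurent
cst c = (c , mono (+ 0) (+ 0) (+ 0)) ∷ []

κ : ℕ → Laurent
κ k = cst (+ k)

x₁ x₂ x₃ : Laurent
x₁ = (+ 1 , mono (+ 1) (+ 0) (+ 0)) ∷ []
x₂ = (+ 1 , mono (+ 0) (+ 1) (+ 0)) ∷ []
x₃ = (+ 1 , mono (+ 0) (+ 0) (+ 1)) ∷ []

x123⁻¹ : Laurent
x123⁻¹ = (+ 1 , mono -[1+ 0 ] -[1+ 0 ] -[1+ 0 ]) ∷ []

-- |a| : value at x₁ = x₂ = x₃ = 1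
∣_∣ : Laurent → ℤ
∣ p ∣ = foldr (λ { (c , _) s → c ℤ.+ s }) (+ 0) p

module _ (k₁ k₂ k₃ : ℕ) where

  -- Labeled clusters, generated from (x₁,x₂,x₃) by mutations.  The
  -- quotient in a mutation is specified as an element a' with
  -- a · a' = numerator (unique up to ≈, the ring being a domain).
  data Labeled : Laurent → Laurent → Laurent → Set where
    base : ∀ {a b c} → a ≈ x₁ → b ≈ x₂ → c ≈ x₃ → Labeled a b c
    mut₁ : ∀ {a b c a'} → Labeled a b c →
           a * a' ≈ b * b + κ k₁ * b * c + c * c → Labeled a' b c
    mut₂ : ∀ {a b c b'} → Labeled a b c →
           b * b' ≈ a * a + κ k₂ * a * c + c * c → Labeled a b' c
    mut₃ : ∀ {a b c c'} → Labeled a b c →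
           c * c' ≈ a * a + κ k₃ * a * b + b * b → Labeled a b c'

  LabeledCluster : Laurent → Laurent → Laurent → Set
  LabeledCluster a b c = ∃[ a' ] ∃[ b' ] ∃[ c' ]
    (Labeled a' b' c' × a ≈ a' × b ≈ b' × c ≈ c')

  NonLabeledCluster : Laurent → Laurent → Laurent → Set
  NonLabeledCluster a b c =
    LabeledCluster a b c ⊎ LabeledCluster a c b ⊎ LabeledCluster b a c ⊎
    LabeledCluster b c a ⊎ LabeledCluster c a b ⊎ LabeledCluster c b a

  -- Parity y k : y is a cluster variable occurring in position i of a
  -- labeled cluster, and k = k_i  (i.e. k = k_y).
  data Parity (y : Laurent) : ℕ → Set where
    pos₁ : ∀ {a b c} → Labeled a b c → y ≈ a → Parity y k₁
    pos₂ : ∀ {a b c} → Labeled a b c → y ≈ b → Parity y k₂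
    pos₃ : ∀ {a b c} → Labeled a b c → y ≈ c → Parity y k₃

  ClusterVariable : Laurent → Set
  ClusterVariable y = ∃[ k ] Parity y k

  𝓜 : Laurent
  𝓜 = (x₁ * x₁ + x₂ * x₂ + x₃ * x₃ + κ k₁ * x₂ * x₃ + κ k₂ * x₁ * x₃ + κ k₃ * x₁ * x₂) * x123⁻¹

record Mat : Set where
  constructor mat
  field
    m₁₁ m₁₂ m₂₁ m₂₂ : Laurent
open Mat public

infix 4 _≈M_
_≈M_ : Mat → Mat → Set
A ≈M B = m₁₁ A ≈ m₁₁ B × m₁₂ A ≈ m₁₂ B × m₂₁ A ≈ m₂₁ B × m₂₂ A ≈ m₂₂ B

infixl 7 _·_
_·_ : Mat → Mat → Mat
A · B = mat (m₁₁ A * m₁₁ B + m₁₂ A * m₂₁ B) (m₁₁ A * m₁₂ B + m₁₂ A * m₂₂ B)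
            (m₂₁ A * m₁₁ B + m₂₂ A * m₂₁ B) (m₂₁ A * m₁₂ B + m₂₂ A * m₂₂ B)

infixl 6 _⊖_
_⊖_ : Mat → Mat → Mat
A ⊖ B = mat (m₁₁ A - m₁₁ B) (m₁₂ A - m₁₂ B) (m₂₁ A - m₂₁ B) (m₂₂ A - m₂₂ B)

negM : Mat → Mat
negM A = mat (- m₁₁ A) (- m₁₂ A) (- m₂₁ A) (- m₂₂ A)

tr : Mat → Laurent
tr A = m₁₁ A + m₂₂ A

det : Mat → Laurent
det A = m₁₁ A * m₂₂ A - m₁₂ A * m₂₁ A

-- adjugate; equals the inverse for matrices of determinant 1
inv : Mat → Mat
inv A = mat (m₂₂ A) (- m₁₂ A) (- m₂₁ A) (m₁₁ A)

InSL2 : Mat → Set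
InSL2 A = det A ≈ cst (+ 1)

module _ (k₁ k₂ k₃ : ℕ) where

  T : Mat
  T = mat (cst -[1+ 0 ]) zeroL (𝓜 k₁ k₂ k₃) (cst -[1+ 0 ])

  S : Mat → Mat
  S P = mat s zeroL (s * 𝓜 k₁ k₂ k₃) s
    where s = 𝓜 k₁ k₂ k₃ * m₁₂ P - tr P

  CGCMatrix : Mat → Set
  CGCMatrix P = InSL2 P ×
    ∃[ k ] (Parity k₁ k₂ k₃ (m₁₂ P) k × tr P ≈ 𝓜 k₁ k₂ k₃ * m₁₂ P - κ k)

  CGCTriple : Mat → Mat → Mat → Laurent → Laurent → Laurent → Set
  CGCTriple P Q R a b c =
    CGCMatrix P × CGCMatrix Q × CGCMatrix R ×
    Q ≈M P · R ⊖ S Q ×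
    m₁₂ P ≈ a × m₁₂ Q ≈ b × m₁₂ R ≈ c ×
    NonLabeledCluster k₁ k₂ k₃ a b c

  CMMMatrix : Mat → Set
  CMMMatrix X = InSL2 X ×
    ∃[ k ] (Parity k₁ k₂ k₃ (m₁₂ X) k × tr X ≈ - κ k)

  CMMTriple : Mat → Mat → Mat → Set
  CMMTriple X Y Z =
    CMMMatrix X × CMMMatrix Y × CMMMatrix Z ×
    X · Y · Z ≈M T ×
    NonLabeledCluster k₁ k₂ k₃ (m₁₂ X) (m₁₂ Y) (m₁₂ Z)

  TraceParity : Mat → Laurent → Set
  TraceParity X a = ∃[ k ] (Parity k₁ k₂ k₃ a k × tr X ≈ - κ k)

  MMDecomposition : Mat → Mat → Mat → Laurent → Laurent → Laurent →
                    Mat → Mat → Mat → Set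
  MMDecomposition P Q R a b c X Y Z =
    CMMTriple X Y Z ×
    P ≈M negM (inv (Y · Z)) × Q ≈M negM (inv (X · Z)) × R ≈M negM (inv (X · Y)) ×
    TraceParity X a × TraceParity Y b × TraceParity Z c

{-# OPTIONS --safe #-}

-- Write P̃, Q̃, R̃ for − P, − Q, − R.  A decomposition is a factorization T = X Y Z with P̃ = (Y Z)⁻¹,
-- Q̃ = (X Z)⁻¹ and R̃ = (X Y)⁻¹.  In any group the conditions on P̃ and R̃ force X = T P̃, Z = R̃ T and
-- Y = (R̃ T P̃)⁻¹; the one on Q̃ then becomes T P̃ R̃ = (T Q̃)⁻¹, which is Q = P R − S_Q by
-- Cayley–Hamilton for T Q.
--
-- It remains to recognize the (1,2)-entry y of Y.  Let tr P = M a − k, tr Q = M b − l, tr R = M c − n,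
-- so that X, Y, Z have traces − k, − l, − n.  Then b y = a² + l a c + c² and b + y = M a c − k c − n a,
-- so y is the mutation of b once l is known to be the parity of the position of b in the cluster, and
-- M a b c = a² + b² + c² + k b c + l a c + n a b.  The cluster satisfies the same equation with its
-- positional parities in place of k, l, n.  Mutations can be undone over the positive rationals, so
-- homomorphisms from the Laurent ring to ℚ give a, b, c any positive values; comparing the two
-- equations at (1, 1, 1) and (1, 2, 1) identifies l.

module Submission where

open import Algebra.Bundles using (CommutativeMonoid; CommutativeRing; Group; RawMonoid; RawRing)
import Algebra.Consequences.Setoid
import Algebra.Morphism.Construct.Identity as Identity
open import Algebra.Morphism.Structures using (IsMonoidHomomorphism; IsRingHomomorphism)
import Algebra.Properties.AbelianGroup
import Algebra.Properties.CommutativeSemigroup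
import Algebra.Properties.Group
import Algebra.Properties.Monoid.Mult.TCOptimised
import Algebra.Properties.Ring
import Algebra.Solver.Ring
open import Algebra.Solver.Ring.AlmostCommutativeRing using (_-Raw-AlmostCommutative⟶_; fromCommutativeRing)
open import Data.Bool using (true; false; if_then_else_)
open import Data.Integer as ℤ using (ℤ; +_; -[1+_]; 0ℤ; 1ℤ; _<_; _⊔_)
import Data.Integer.Properties as ℤ
open import Data.List using (List; []; _∷_; _++_; map; deduplicate)
open import Data.List.Membership.Propositional using (_∈_; _∉_)
open import Data.List.Membership.Propositional.Properties using (∈-++⁺ˡ; ∈-++⁺ʳ; ∈-deduplicate⁺; ∈-map⁺)
open import Data.List.Properties using (++-assoc; map-cong)
open import Data.List.Relation.Unary.All as All using (All; []; _∷_)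
open import Data.List.Relation.Unary.All.Properties using (All¬⇒¬Any)
open import Data.List.Relation.Unary.AllPairs using (_∷_)
open import Data.List.Relation.Unary.Any using (here; there)
open import Data.List.Relation.Unary.Unique.DecPropositional.Properties using (deduplicate-!)
open import Data.List.Relation.Unary.Unique.Propositional using (Unique)
open import Data.Maybe using (Maybe; just; nothing)
open import Data.Nat as ℕ using (ℕ; zero; suc)
import Data.Nat.Properties as ℕ
open import Data.Product using (_×_; _,_; proj₁; proj₂; Σ; ∃-syntax)
open import Data.Rational as ℚ using (ℚ; 0ℚ; 1ℚ; Positive; NonNegative; 1/_)
import Data.Rational.Properties as ℚ
open import Data.Sum using (inj₁; inj₂)
open import Function using (_∘_; const; id)
open import Level using (0ℓ)
open import Relation.Binary.Bundles using (Setoid)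
open import Relation.Binary.Definitions using (DecidableEquality)
open import Relation.Binary.PropositionalEquality as ≡ using (_≡_)
import Relation.Binary.Reasoning.Setoid as SetoidReasoning
open import Relation.Nullary using (yes; no; contradiction; Reflects; ofʸ; ofⁿ; _because_)

module TripleFactorization {c ℓ} (G : Group c ℓ) where

  open Group G
  open Algebra.Properties.Group G
  open SetoidReasoning setoid

  x≈y⁻¹⇒y≈x⁻¹ : ∀ {x y} → x ≈ y ⁻¹ → y ≈ x ⁻¹
  x≈y⁻¹⇒y≈x⁻¹ x≈y⁻¹ = sym (⁻¹-selfInverse (sym x≈y⁻¹))

  middle-factor : ∀ X Y Z {T} → X ∙ Y ∙ Z ≈ T → Y ≈ X ⁻¹ ∙ T ∙ Z ⁻¹
  middle-factor X Y Z {T} XYZ≈T = begin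
    Y                              ≈⟨ //-rightDividesʳ Z Y ⟨
    Y ∙ Z ∙ Z ⁻¹                   ≈⟨ ∙-congʳ (\\-leftDividesʳ X (Y ∙ Z)) ⟨
    X ⁻¹ ∙ (X ∙ (Y ∙ Z)) ∙ Z ⁻¹    ≈⟨ ∙-congʳ (∙-congˡ (assoc X Y Z)) ⟨
    X ⁻¹ ∙ (X ∙ Y ∙ Z) ∙ Z ⁻¹      ≈⟨ ∙-congʳ (∙-congˡ XYZ≈T) ⟩
    X ⁻¹ ∙ T ∙ Z ⁻¹                ∎

  record Factorization (T P Q R X Y Z : Carrier) : Set ℓ where
    field
      XYZ≈T : X ∙ Y ∙ Z ≈ T
      P≈[YZ]⁻¹ : P ≈ (Y ∙ Z) ⁻¹
      Q≈[XZ]⁻¹ : Q ≈ (X ∙ Z) ⁻¹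
      R≈[XY]⁻¹ : R ≈ (X ∙ Y) ⁻¹

  factorization : ∀ T P Q R → T ∙ (P ∙ R) ≈ (T ∙ Q) ⁻¹ →
    Factorization T P Q R (T ∙ P) ((R ∙ T ∙ P) ⁻¹) (R ∙ T)
  factorization T P Q R TPR≈[TQ]⁻¹ = record
    { XYZ≈T = trans (∙-congʳ XY≈R⁻¹) (\\-leftDividesʳ R T)
    ; P≈[YZ]⁻¹ = x≈y⁻¹⇒y≈x⁻¹ YZ≈P⁻¹
    ; Q≈[XZ]⁻¹ = x≈y⁻¹⇒y≈x⁻¹ XZ≈Q⁻¹
    ; R≈[XY]⁻¹ = x≈y⁻¹⇒y≈x⁻¹ XY≈R⁻¹
    }
    where
    XY≈R⁻¹ : T ∙ P ∙ (R ∙ T ∙ P) ⁻¹ ≈ R ⁻¹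
    XY≈R⁻¹ = begin
      T ∙ P ∙ (R ∙ T ∙ P) ⁻¹         ≈⟨ ∙-congˡ (⁻¹-cong (assoc R T P)) ⟩
      T ∙ P ∙ (R ∙ (T ∙ P)) ⁻¹       ≈⟨ ∙-congˡ (⁻¹-anti-homo-∙ R (T ∙ P)) ⟩
      T ∙ P ∙ ((T ∙ P) ⁻¹ ∙ R ⁻¹)    ≈⟨ \\-leftDividesˡ (T ∙ P) (R ⁻¹) ⟩
      R ⁻¹                           ∎
    YZ≈P⁻¹ : (R ∙ T ∙ P) ⁻¹ ∙ (R ∙ T) ≈ P ⁻¹
    YZ≈P⁻¹ = begin
      (R ∙ T ∙ P) ⁻¹ ∙ (R ∙ T)       ≈⟨ ∙-congʳ (⁻¹-anti-homo-∙ (R ∙ T) P) ⟩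
      P ⁻¹ ∙ (R ∙ T) ⁻¹ ∙ (R ∙ T)    ≈⟨ //-rightDividesˡ (R ∙ T) (P ⁻¹) ⟩
      P ⁻¹                           ∎
    XZ≈Q⁻¹ : T ∙ P ∙ (R ∙ T) ≈ Q ⁻¹
    XZ≈Q⁻¹ = begin
      T ∙ P ∙ (R ∙ T)                ≈⟨ assoc (T ∙ P) R T ⟨
      T ∙ P ∙ R ∙ T                  ≈⟨ ∙-congʳ (assoc T P R) ⟩
      T ∙ (P ∙ R) ∙ T                ≈⟨ ∙-congʳ TPR≈[TQ]⁻¹ ⟩
      (T ∙ Q) ⁻¹ ∙ T                 ≈⟨ ∙-congʳ (⁻¹-anti-homo-∙ T Q) ⟩
      Q ⁻¹ ∙ T ⁻¹ ∙ T                ≈⟨ //-rightDividesˡ T (Q ⁻¹) ⟩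
      Q ⁻¹                           ∎

  factorization-unique : ∀ {T P Q R X Y Z} → Factorization T P Q R X Y Z →
    X ≈ T ∙ P × Y ≈ (R ∙ T ∙ P) ⁻¹ × Z ≈ R ∙ T
  factorization-unique {T} {P} {Q} {R} {X} {Y} {Z} F = X≈TP , Y≈[RTP]⁻¹ , Z≈RT
    where
    open Factorization F
    X≈TP : X ≈ T ∙ P
    X≈TP = begin
      X                              ≈⟨ //-rightDividesʳ (Y ∙ Z) X ⟨
      X ∙ (Y ∙ Z) ∙ (Y ∙ Z) ⁻¹       ≈⟨ ∙-cong (sym (assoc X Y Z)) (sym P≈[YZ]⁻¹) ⟩
      X ∙ Y ∙ Z ∙ P                  ≈⟨ ∙-congʳ XYZ≈T ⟩
      T ∙ P                          ∎
    Z≈RT : Z ≈ R ∙ T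
    Z≈RT = begin
      Z                              ≈⟨ \\-leftDividesʳ (X ∙ Y) Z ⟨
      (X ∙ Y) ⁻¹ ∙ (X ∙ Y ∙ Z)       ≈⟨ ∙-cong (sym R≈[XY]⁻¹) XYZ≈T ⟩
      R ∙ T                          ∎
    Y≈[RTP]⁻¹ : Y ≈ (R ∙ T ∙ P) ⁻¹
    Y≈[RTP]⁻¹ = x≈y⁻¹⇒y≈x⁻¹ (sym (begin
      Y ⁻¹                           ≈⟨ \\-leftDividesˡ Z (Y ⁻¹) ⟨
      Z ∙ (Z ⁻¹ ∙ Y ⁻¹)              ≈⟨ ∙-cong Z≈RT (sym (⁻¹-anti-homo-∙ Y Z)) ⟩
      R ∙ T ∙ (Y ∙ Z) ⁻¹             ≈⟨ ∙-congˡ P≈[YZ]⁻¹ ⟨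
      R ∙ T ∙ P                      ∎))

module IntegerPower {c ℓ} (M : CommutativeMonoid c ℓ) where

  open CommutativeMonoid M
  open Algebra.Properties.Monoid.Mult.TCOptimised monoid using (1+×; ×-homo-+) renaming (_×_ to _×ₙ_)
  open Algebra.Properties.CommutativeSemigroup commutativeSemigroup using (interchange)
  open SetoidReasoning setoid

  module _ {u u⁻¹} (inverse : u ∙ u⁻¹ ≈ ε) where

    power : ℤ → Carrier
    power (+ n) = n ×ₙ u
    power -[1+ n ] = suc n ×ₙ u⁻¹

    power-⊖ : ∀ m n → power (m ℤ.⊖ n) ≈ m ×ₙ u ∙ n ×ₙ u⁻¹
    power-⊖ zero zero = sym (identityˡ ε)
    power-⊖ zero (suc n) = sym (identityˡ _)
    power-⊖ (suc m) zero = sym (identityʳ _)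
    power-⊖ (suc m) (suc n) = begin
      power (suc m ℤ.⊖ suc n)                ≡⟨ ≡.cong power (ℤ.[1+m]⊖[1+n]≡m⊖n m n) ⟩
      power (m ℤ.⊖ n)                        ≈⟨ power-⊖ m n ⟩
      m ×ₙ u ∙ n ×ₙ u⁻¹                      ≈⟨ identityˡ _ ⟨
      ε ∙ (m ×ₙ u ∙ n ×ₙ u⁻¹)                ≈⟨ ∙-congʳ inverse ⟨
      u ∙ u⁻¹ ∙ (m ×ₙ u ∙ n ×ₙ u⁻¹)          ≈⟨ interchange u u⁻¹ (m ×ₙ u) (n ×ₙ u⁻¹) ⟩
      (u ∙ m ×ₙ u) ∙ (u⁻¹ ∙ n ×ₙ u⁻¹)        ≈⟨ ∙-cong (1+× m u) (1+× n u⁻¹) ⟨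
      suc m ×ₙ u ∙ suc n ×ₙ u⁻¹              ∎

    power-+ : ∀ i j → power (i ℤ.+ j) ≈ power i ∙ power j
    power-+ (+ m) (+ n) = ×-homo-+ u m n
    power-+ (+ m) -[1+ n ] = power-⊖ m (suc n)
    power-+ -[1+ m ] (+ n) = trans (power-⊖ n (suc m)) (comm _ _)
    power-+ -[1+ m ] -[1+ n ] = begin
      suc (suc (m ℕ.+ n)) ×ₙ u⁻¹             ≡⟨ ≡.cong (_×ₙ u⁻¹) (ℕ.+-suc (suc m) n) ⟨
      (suc m ℕ.+ suc n) ×ₙ u⁻¹               ≈⟨ ×-homo-+ u⁻¹ (suc m) (suc n) ⟩
      suc m ×ₙ u⁻¹ ∙ suc n ×ₙ u⁻¹            ∎

module AdditiveMaps {c ℓ} (G : Group c ℓ) where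

  open Group G
  open Algebra.Properties.Group G
  open SetoidReasoning setoid

  Additive : (ℤ → Carrier) → Set ℓ
  Additive f = ∀ i j → f (i ℤ.+ j) ≈ f i ∙ f j

  additive-0 : ∀ {f} → Additive f → f 0ℤ ≈ ε
  additive-0 {f} f-+ = identityˡ-unique (f 0ℤ) (f 0ℤ) (sym (f-+ 0ℤ 0ℤ))

  additive-neg : ∀ {f} → Additive f → ∀ i → f (ℤ.- i) ≈ f i ⁻¹
  additive-neg {f} f-+ i = inverseˡ-unique (f (ℤ.- i)) (f i) (begin
    f (ℤ.- i) ∙ f i      ≈⟨ f-+ (ℤ.- i) i ⟨
    f (ℤ.- i ℤ.+ i)      ≡⟨ ≡.cong f (ℤ.+-inverseˡ i) ⟩
    f 0ℤ                 ≈⟨ additive-0 f-+ ⟩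
    ε                    ∎)

  additive-unique : ∀ {f g} → Additive f → Additive g → f 1ℤ ≈ g 1ℤ → ∀ i → f i ≈ g i
  additive-unique {f} {g} f-+ g-+ f1≈g1 = λ where
      (+ n) → on-ℕ n
      -[1+ n ] → begin
        f -[1+ n ]       ≈⟨ additive-neg f-+ (+ suc n) ⟩
        f (+ suc n) ⁻¹   ≈⟨ ⁻¹-cong (on-ℕ (suc n)) ⟩
        g (+ suc n) ⁻¹   ≈⟨ additive-neg g-+ (+ suc n) ⟨
        g -[1+ n ]       ∎
    where
    on-ℕ : ∀ n → f (+ n) ≈ g (+ n)
    on-ℕ zero = trans (additive-0 f-+) (sym (additive-0 g-+))
    on-ℕ (suc n) = begin
      f (1ℤ ℤ.+ + n)     ≈⟨ f-+ 1ℤ (+ n) ⟩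
      f 1ℤ ∙ f (+ n)     ≈⟨ ∙-cong f1≈g1 (on-ℕ n) ⟩
      g 1ℤ ∙ g (+ n)     ≈⟨ g-+ 1ℤ (+ n) ⟨
      g (1ℤ ℤ.+ + n)     ∎

module IntegerMultiples {c ℓ} (R : CommutativeRing c ℓ) where

  open CommutativeRing R
  open AdditiveMaps +-group public
  open IntegerPower +-commutativeMonoid

  -- 0ℤ and 1ℤ are sent to 0# and 1# definitionally, so that the solver recognizes these constants.
  ι : ℤ → Carrier
  ι = power (-‿inverseʳ 1#)

  ι-+ : Additive ι
  ι-+ = power-+ (-‿inverseʳ 1#)

  ι-neg : ∀ i → ι (ℤ.- i) ≈ - ι i
  ι-neg = additive-neg ι-+

  ι-* : ∀ i j → ι (i ℤ.* j) ≈ ι i * ι j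
  ι-* i j = additive-unique
    (λ i i′ → trans (reflexive (≡.cong ι (ℤ.*-distribʳ-+ j i i′))) (ι-+ (i ℤ.* j) (i′ ℤ.* j)))
    (λ i i′ → trans (*-congʳ (ι-+ i i′)) (distribʳ (ι j) (ι i) (ι i′)))
    (trans (reflexive (≡.cong ι (ℤ.*-identityˡ j))) (sym (*-identityˡ (ι j))))
    i

module IntegerSolver {c ℓ} (R : CommutativeRing c ℓ) where

  open CommutativeRing R
  open IntegerMultiples R

  private
    ι-homomorphism : ℤ.+-*-rawRing -Raw-AlmostCommutative⟶ fromCommutativeRing R
    ι-homomorphism = record
      { ⟦_⟧ = ι ; +-homo = ι-+ ; *-homo = ι-* ; -‿homo = ι-neg ; 0-homo = refl ; 1-homo = refl }

    ι-≟ : ∀ i j → Maybe (ι i ≈ ι j)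
    ι-≟ i j with i ℤ.≟ j
    ... | yes ≡.refl = just refl
    ... | no _ = nothing

  open Algebra.Solver.Ring ℤ.+-*-rawRing (fromCommutativeRing R) ι-homomorphism ι-≟ public
    using (Polynomial; solve; _:+_; _:*_; :-_; _:-_; _:=_; con)

  polynomialRing : ℕ → RawRing 0ℓ 0ℓ
  polynomialRing n = record
    { Carrier = Polynomial n ; _≈_ = _≡_ ; _+_ = _:+_ ; _*_ = _:*_ ; -_ = :-_ ; 0# = con 0ℤ ; 1# = con 1ℤ }

record Mat₂ {c} (C : Set c) : Set c where
  constructor mat₂
  field
    e₁₁ e₁₂ e₂₁ e₂₂ : C
open Mat₂

-- Over a raw ring, so as to apply to the polynomials of the ring solver as well.
module RawMatrices {c ℓ} (R : RawRing c ℓ) where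

  open RawRing R

  infixl 7 _·_
  infixl 6 _⊕_ _⊖_

  _·_ _⊕_ _⊖_ : (A B : Mat₂ Carrier) → Mat₂ Carrier
  mat₂ a b c d · mat₂ e f g h =
    mat₂ (a * e + b * g) (a * f + b * h) (c * e + d * g) (c * f + d * h)
  mat₂ a b c d ⊕ mat₂ e f g h = mat₂ (a + e) (b + f) (c + g) (d + h)
  mat₂ a b c d ⊖ mat₂ e f g h = mat₂ (a + - e) (b + - f) (c + - g) (d + - h)

  neg adj : Mat₂ Carrier → Mat₂ Carrier
  neg (mat₂ a b c d) = mat₂ (- a) (- b) (- c) (- d)
  adj (mat₂ a b c d) = mat₂ d (- b) (- c) a

  scalar : Carrier → Mat₂ Carrier
  scalar s = mat₂ s 0# 0# s

  tr det : Mat₂ Carrier → Carrier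
  tr (mat₂ a b c d) = a + d
  det (mat₂ a b c d) = a * d + - (b * c)

  infix 4 _≈₂_
  _≈₂_ : (A B : Mat₂ Carrier) → Set ℓ
  A ≈₂ B = e₁₁ A ≈ e₁₁ B × e₁₂ A ≈ e₁₂ B × e₂₁ A ≈ e₂₁ B × e₂₂ A ≈ e₂₂ B

module SpecialLinear {c ℓ} (R : CommutativeRing c ℓ) where

  open CommutativeRing R
  open RawMatrices rawRing public
  open IntegerSolver R
  open Algebra.Properties.AbelianGroup +-abelianGroup using (⁻¹-selfInverse; //-rightDividesˡ)
  private module Poly {n : ℕ} = RawMatrices (polynomialRing n)

  ≈₂-setoid : Setoid c ℓ
  ≈₂-setoid = record
    { _≈_ = _≈₂_
    ; isEquivalence = record
      { refl = refl , refl , refl , refl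
      ; sym = λ (p , q , r , s) → sym p , sym q , sym r , sym s
      ; trans = λ (p , q , r , s) (p′ , q′ , r′ , s′) → trans p p′ , trans q q′ , trans r r′ , trans s s′ } }

  open Setoid ≈₂-setoid public using () renaming (refl to ≈₂-refl; sym to ≈₂-sym; trans to ≈₂-trans)

  ·-cong : ∀ {A A′ B B′} → A ≈₂ A′ → B ≈₂ B′ → A · B ≈₂ A′ · B′
  ·-cong (a , b , c , d) (e , f , g , h) = dot a e b g , dot a f b h , dot c e d g , dot c f d h
    where
    dot : ∀ {a b c d a′ b′ c′ d′} → a ≈ a′ → b ≈ b′ → c ≈ c′ → d ≈ d′ → a * b + c * d ≈ a′ * b′ + c′ * d′
    dot p q r s = +-cong (*-cong p q) (*-cong r s)

  adj-cong : ∀ {A B} → A ≈₂ B → adj A ≈₂ adj B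
  adj-cong (p , q , r , s) = s , -‿cong q , -‿cong r , p

  neg-transpose : ∀ {A B} → neg A ≈₂ B → A ≈₂ neg B
  neg-transpose (p , q , r , s) = move p , move q , move r , move s
    where
    move : ∀ {x y} → - x ≈ y → x ≈ - y
    move -x≈y = sym (⁻¹-selfInverse -x≈y)

  ·-assoc : ∀ A B C → A · B · C ≈₂ A · (B · C)
  ·-assoc (mat₂ a b c d) (mat₂ e f g h) (mat₂ i j k l) =
    entry a b i k , entry a b j l , entry c d i k , entry c d j l
    where
    entry : ∀ a b i k → (a * e + b * g) * i + (a * f + b * h) * k ≈ a * (e * i + f * k) + b * (g * i + h * k)
    entry a b i k = solve 8 (λ a b e f g h i k →
      (a :* e :+ b :* g) :* i :+ (a :* f :+ b :* h) :* k := a :* (e :* i :+ f :* k) :+ b :* (g :* i :+ h :* k))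
      refl a b e f g h i k

  ·-identityˡ : ∀ A → scalar 1# · A ≈₂ A
  ·-identityˡ (mat₂ a b c d) = first a c , first b d , second a c , second b d
    where
    first : ∀ x y → 1# * x + 0# * y ≈ x
    first = solve 2 (λ x y → con 1ℤ :* x :+ con 0ℤ :* y := x) refl
    second : ∀ x y → 0# * x + 1# * y ≈ y
    second = solve 2 (λ x y → con 0ℤ :* x :+ con 1ℤ :* y := y) refl

  ·-identityʳ : ∀ A → A · scalar 1# ≈₂ A
  ·-identityʳ (mat₂ a b c d) = first a b , second a b , first c d , second c d
    where
    first : ∀ x y → x * 1# + y * 0# ≈ x
    first = solve 2 (λ x y → x :* con 1ℤ :+ y :* con 0ℤ := x) refl
    second : ∀ x y → x * 0# + y * 1# ≈ y
    second = solve 2 (λ x y → x :* con 0ℤ :+ y :* con 1ℤ := y) refl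

  ·-adj : ∀ A → A · adj A ≈₂ scalar (det A)
  ·-adj (mat₂ a b c d) =
      solve 4 (λ a b c d → a :* d :+ b :* :- c := a :* d :- b :* c) refl a b c d
    , solve 2 (λ a b → a :* :- b :+ b :* a := con 0ℤ) refl a b
    , solve 2 (λ c d → c :* d :+ d :* :- c := con 0ℤ) refl c d
    , solve 4 (λ a b c d → c :* :- b :+ d :* a := a :* d :- b :* c) refl a b c d

  adj-· : ∀ A → adj A · A ≈₂ scalar (det A)
  adj-· (mat₂ a b c d) =
      solve 4 (λ a b c d → d :* a :+ :- b :* c := a :* d :- b :* c) refl a b c d
    , solve 2 (λ b d → d :* b :+ :- b :* d := con 0ℤ) refl b d
    , solve 2 (λ a c → :- c :* a :+ a :* c := con 0ℤ) refl a c
    , solve 4 (λ a b c d → :- c :* b :+ a :* d := a :* d :- b :* c) refl a b c d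

  det-scalar : ∀ s → det (scalar s) ≈ s * s
  det-scalar = solve 1 (λ s → Poly.det (Poly.scalar s) := s :* s) refl

  det-· : ∀ A B → det (A · B) ≈ det A * det B
  det-· (mat₂ a b c d) (mat₂ e f g h) = solve 8 (λ a b c d e f g h →
    let A = mat₂ a b c d ; B = mat₂ e f g h in Poly.det (A Poly.· B) := Poly.det A :* Poly.det B)
    refl a b c d e f g h

  det-adj : ∀ A → det (adj A) ≈ det A
  det-adj (mat₂ a b c d) = solve 4 (λ a b c d →
    let A = mat₂ a b c d in Poly.det (Poly.adj A) := Poly.det A) refl a b c d

  det-neg : ∀ A → det (neg A) ≈ det A
  det-neg (mat₂ a b c d) = solve 4 (λ a b c d →
    let A = mat₂ a b c d in Poly.det (Poly.neg A) := Poly.det A) refl a b c d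

  tr-cong : ∀ {A B} → A ≈₂ B → tr A ≈ tr B
  tr-cong (p , _ , _ , s) = +-cong p s

  tr-adj : ∀ A → tr (adj A) ≈ tr A
  tr-adj A = +-comm (e₂₂ A) (e₁₁ A)

  tr-·-comm : ∀ A B → tr (A · B) ≈ tr (B · A)
  tr-·-comm (mat₂ a b c d) (mat₂ e f g h) = solve 8 (λ a b c d e f g h →
    let A = mat₂ a b c d ; B = mat₂ e f g h in Poly.tr (A Poly.· B) := Poly.tr (B Poly.· A))
    refl a b c d e f g h

  ·-negʳ : ∀ A B → A · neg B ≈₂ neg (A · B)
  ·-negʳ (mat₂ a b c d) (mat₂ e f g h) = entry a b e g , entry a b f h , entry c d e g , entry c d f h
    where
    entry : ∀ a b e g → a * - e + b * - g ≈ - (a * e + b * g)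
    entry = solve 4 (λ a b e g → a :* :- e :+ b :* :- g := :- (a :* e :+ b :* g)) refl

  neg·neg : ∀ A B → neg A · neg B ≈₂ A · B
  neg·neg (mat₂ a b c d) (mat₂ e f g h) = entry a b e g , entry a b f h , entry c d e g , entry c d f h
    where
    entry : ∀ a b e g → - a * - e + - b * - g ≈ a * e + b * g
    entry = solve 4 (λ a b e g → :- a :* :- e :+ :- b :* :- g := a :* e :+ b :* g) refl

  cayley-hamilton : ∀ A → A ⊖ scalar (tr A) ≈₂ neg (adj A)
  cayley-hamilton (mat₂ a b c d) =
      solve 2 (λ a d → a :- (a :+ d) := :- d) refl a d
    , off-diagonal b
    , off-diagonal c
    , solve 2 (λ a d → d :- (a :+ d) := :- a) refl a d
    where
    off-diagonal : ∀ x → x - 0# ≈ - - x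
    off-diagonal = solve 1 (λ x → x :- con 0ℤ := :- (:- x)) refl

  ⊖-transpose : ∀ {A B C} → A ≈₂ B ⊖ C → B ≈₂ A ⊕ C
  ⊖-transpose (p , q , r , s) = move p , move q , move r , move s
    where
    move : ∀ {x y z} → x ≈ y - z → y ≈ x + z
    move {x} {y} {z} x≈y-z = trans (sym (//-rightDividesˡ z y)) (+-congʳ (sym x≈y-z))

  infix 3 _#_
  record SL₂ : Set (c Level.⊔ ℓ) where
    constructor _#_
    field
      matrix : Mat₂ Carrier
      det≈1 : det matrix ≈ 1#
  open SL₂ public

  SL₂-group : Group (c Level.⊔ ℓ) ℓ
  SL₂-group = record
    { Carrier = SL₂
    ; _≈_ = λ A B → matrix A ≈₂ matrix B
    ; _∙_ = λ (A # detA) (B # detB) →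
        A · B # trans (det-· A B) (trans (*-cong detA detB) (*-identityˡ 1#))
    ; ε = scalar 1# # trans (det-scalar 1#) (*-identityˡ 1#)
    ; _⁻¹ = λ (A # detA) → adj A # trans (det-adj A) detA
    ; isGroup = record
      { isMonoid = record
        { isSemigroup = record
          { isMagma = record
            { isEquivalence = record { refl = ≈₂-refl ; sym = ≈₂-sym ; trans = ≈₂-trans }
            ; ∙-cong = ·-cong }
          ; assoc = λ A B C → ·-assoc (matrix A) (matrix B) (matrix C) }
        ; identity = ·-identityˡ ∘ matrix , ·-identityʳ ∘ matrix }
      ; inverse = (λ (A # detA) → ≈₂-trans (adj-· A) (detA , refl , refl , detA))
                , (λ (A # detA) → ≈₂-trans (·-adj A) (detA , refl , refl , detA))
      ; ⁻¹-cong = adj-cong }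
    }

  negate : SL₂ → SL₂
  negate (A # detA) = neg A # trans (det-neg A) detA

module RawMarkov {c ℓ} (R : RawRing c ℓ) where

  open RawRing R

  exchangeForm : (k b c : Carrier) → Carrier
  exchangeForm k b c = b * b + k * b * c + c * c

  markovForm : (k l n a b c : Carrier) → Carrier
  markovForm k l n a b c = a * a + b * b + c * c + k * (b * c) + l * (a * c) + n * (a * b)

  -- Records rather than abbreviations, so that the arguments can be inferred from a proof.
  record Exchange (k a a′ b c : Carrier) : Set ℓ where
    constructor holds
    field
      equation : a * a′ ≈ exchangeForm k b c

  record Markov (M k l n a b c : Carrier) : Set ℓ where
    constructor holds
    field
      equation : M * (a * b * c) ≈ markovForm k l n a b c

module MarkovMorphism {a ℓᵃ b ℓᵇ} (A : CommutativeRing a ℓᵃ) (B : CommutativeRing b ℓᵇ)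
  {φ : CommutativeRing.Carrier A → CommutativeRing.Carrier B}
  (isRingHomomorphism : IsRingHomomorphism (CommutativeRing.rawRing A) (CommutativeRing.rawRing B) φ) where

  private
    module A = CommutativeRing A
    module RawA = RawMarkov A.rawRing
  open CommutativeRing B
  open RawMarkov rawRing
  open IsRingHomomorphism isRingHomomorphism

  infixl 6 _⟨+⟩_
  infixl 7 _⟨*⟩_
  _⟨+⟩_ : ∀ {p q x y} → φ p ≈ x → φ q ≈ y → φ (p A.+ q) ≈ x + y
  p↦x ⟨+⟩ q↦y = trans (+-homo _ _) (+-cong p↦x q↦y)
  _⟨*⟩_ : ∀ {p q x y} → φ p ≈ x → φ q ≈ y → φ (p A.* q) ≈ x * y
  p↦x ⟨*⟩ q↦y = trans (*-homo _ _) (*-cong p↦x q↦y)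

  exchange-map : ∀ {k a a′ b c k′ u u′ v w} →
    φ k ≈ k′ → φ a ≈ u → φ a′ ≈ u′ → φ b ≈ v → φ c ≈ w →
    RawA.Exchange k a a′ b c → Exchange k′ u u′ v w
  exchange-map k a a′ b c (holds eq) =
    holds (trans (sym (a ⟨*⟩ a′)) (trans (⟦⟧-cong eq) (b ⟨*⟩ b ⟨+⟩ k ⟨*⟩ b ⟨*⟩ c ⟨+⟩ c ⟨*⟩ c)))

  markov-map : ∀ {M k l n a b c k′ l′ n′ u v w} →
    φ k ≈ k′ → φ l ≈ l′ → φ n ≈ n′ → φ a ≈ u → φ b ≈ v → φ c ≈ w →
    RawA.Markov M k l n a b c → Markov (φ M) k′ l′ n′ u v w
  markov-map k l n a b c (holds eq) = holds (trans (sym (refl ⟨*⟩ (a ⟨*⟩ b ⟨*⟩ c))) (trans (⟦⟧-cong eq)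
    (a ⟨*⟩ a ⟨+⟩ b ⟨*⟩ b ⟨+⟩ c ⟨*⟩ c ⟨+⟩ k ⟨*⟩ (b ⟨*⟩ c) ⟨+⟩ l ⟨*⟩ (a ⟨*⟩ c) ⟨+⟩ n ⟨*⟩ (a ⟨*⟩ b))))

module MarkovEquation {c ℓ} (R : CommutativeRing c ℓ) where

  open CommutativeRing R
  open RawMarkov rawRing public
  open IntegerSolver R
  open Algebra.Properties.CommutativeSemigroup *-commutativeSemigroup using (xy∙z≈xz∙y)
  open SetoidReasoning setoid
  private module Poly {n : ℕ} = RawMarkov (polynomialRing n)

  private module Id = MarkovMorphism R R (Identity.isRingHomomorphism rawRing refl)

  exchange-cong : ∀ {k a a′ b c x x′ y z} → a ≈ x → a′ ≈ x′ → b ≈ y → c ≈ z →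
    Exchange k a a′ b c → Exchange k x x′ y z
  exchange-cong = Id.exchange-map refl

  markov-cong : ∀ {M k l n a b c a′ b′ c′} → a ≈ a′ → b ≈ b′ → c ≈ c′ →
    Markov M k l n a b c → Markov M k l n a′ b′ c′
  markov-cong = Id.markov-map refl refl refl

  exchange-comm : ∀ {k a a′ b c} → Exchange k a a′ b c → Exchange k a a′ c b
  exchange-comm {k} {b = b} {c} (holds eq) = holds (trans eq (solve 3 (λ k b c →
    Poly.exchangeForm k b c := Poly.exchangeForm k c b) refl k b c))

  markov-swap₁₂ : ∀ {M k l n a b c} → Markov M k l n a b c → Markov M l k n b a c
  markov-swap₁₂ {M} {k} {l} {n} {a} {b} {c} (holds eq) = holds (begin
    M * (b * a * c)          ≈⟨ *-congˡ (*-congʳ (*-comm b a)) ⟩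
    M * (a * b * c)          ≈⟨ eq ⟩
    markovForm k l n a b c   ≈⟨ solve 6 (λ k l n a b c →
                                  Poly.markovForm k l n a b c := Poly.markovForm l k n b a c) refl k l n a b c ⟩
    markovForm l k n b a c   ∎)

  markov-swap₂₃ : ∀ {M k l n a b c} → Markov M k l n a b c → Markov M k n l a c b
  markov-swap₂₃ {M} {k} {l} {n} {a} {b} {c} (holds eq) = holds (begin
    M * (a * c * b)          ≈⟨ *-congˡ (xy∙z≈xz∙y a c b) ⟩
    M * (a * b * c)          ≈⟨ eq ⟩
    markovForm k l n a b c   ≈⟨ solve 6 (λ k l n a b c →
                                  Poly.markovForm k l n a b c := Poly.markovForm k n l a c b) refl k l n a b c ⟩
    markovForm k n l a c b   ∎)

  markov-quotient : ∀ {k l n a b c d} → d * (a * b * c) ≈ 1# →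
    Markov ((a * a + b * b + c * c + k * b * c + l * a * c + n * a * b) * d) k l n a b c
  markov-quotient {k} {l} {n} {a} {b} {c} {d} d*abc≈1 = holds (begin
    N * d * (a * b * c)      ≈⟨ *-assoc N d (a * b * c) ⟩
    N * (d * (a * b * c))    ≈⟨ *-congˡ d*abc≈1 ⟩
    N * 1#                   ≈⟨ *-identityʳ N ⟩
    N                        ≈⟨ solve 6 (λ k l n a b c →
                                  a :* a :+ b :* b :+ c :* c :+ k :* b :* c :+ l :* a :* c :+ n :* a :* b
                                    := Poly.markovForm k l n a b c) refl k l n a b c ⟩
    markovForm k l n a b c   ∎)
    where
    N : Carrier
    N = a * a + b * b + c * c + k * b * c + l * a * c + n * a * b

  markovForm-quadratic : ∀ k l n a b c →
    markovForm k l n a b c ≈ exchangeForm k b c + a * (a + l * c + n * b)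
  markovForm-quadratic = solve 6 (λ k l n a b c →
    Poly.markovForm k l n a b c := Poly.exchangeForm k b c :+ a :* (a :+ l :* c :+ n :* b)) refl

  -- As a quadratic in its first variable, the equation has the roots a and a′: the exchange relation
  -- is their product, so the equation for a says what their sum is.
  markov-vieta : ∀ {M k l n a a′ b c} → (∀ {x y} → a * x ≈ a * y → x ≈ y) →
    Exchange k a a′ b c → Markov M k l n a b c → Markov M k l n a′ b c
  markov-vieta {M} {k} {l} {n} {a} {a′} {b} {c} a-cancelˡ (holds exchange) (holds markov) = holds (begin
    M * (a′ * b * c)                                 ≈⟨ extract a′ ⟩
    a′ * (M * (b * c))                               ≈⟨ *-congˡ sum-of-roots ⟩
    a′ * (a + a′ + l * c + n * b)                    ≈⟨ solve 6 (λ l n a a′ b c →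
                                                          a′ :* (a :+ a′ :+ l :* c :+ n :* b)
                                                            := a :* a′ :+ a′ :* (a′ :+ l :* c :+ n :* b))
                                                          refl l n a a′ b c ⟩
    a * a′ + a′ * (a′ + l * c + n * b)               ≈⟨ +-congʳ exchange ⟩
    exchangeForm k b c + a′ * (a′ + l * c + n * b)   ≈⟨ markovForm-quadratic k l n a′ b c ⟨
    markovForm k l n a′ b c                          ∎)
    where
    extract : ∀ x → M * (x * b * c) ≈ x * (M * (b * c))
    extract x = solve 4 (λ M x b c → M :* (x :* b :* c) := x :* (M :* (b :* c))) refl M x b c
    sum-of-roots : M * (b * c) ≈ a + a′ + l * c + n * b
    sum-of-roots = a-cancelˡ (begin
      a * (M * (b * c))                              ≈⟨ extract a ⟨
      M * (a * b * c)                                ≈⟨ markov ⟩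
      markovForm k l n a b c                         ≈⟨ markovForm-quadratic k l n a b c ⟩
      exchangeForm k b c + a * (a + l * c + n * b)   ≈⟨ +-congʳ exchange ⟨
      a * a′ + a * (a + l * c + n * b)               ≈⟨ solve 6 (λ l n a a′ b c →
                                                          a :* a′ :+ a :* (a :+ l :* c :+ n :* b)
                                                            := a :* (a :+ a′ :+ l :* c :+ n :* b))
                                                          refl l n a a′ b c ⟩
      a * (a + a′ + l * c + n * b)                   ∎)

  markovForm-middle : ∀ k l n →
    l ≈ (1# + 1#) * markovForm k l n 1# 1# 1# - markovForm k l n 1# (1# + 1#) 1#
  markovForm-middle = solve 3 (λ k l n →
    l := (one :+ one) :* Poly.markovForm k l n one one one :- Poly.markovForm k l n one (one :+ one) one) refl
    where
    one : ∀ {n} → Polynomial n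
    one = con 1ℤ

module RawMonodromy {c ℓ} (R : RawRing c ℓ) where

  open RawRing R
  open RawMatrices R

  T : Carrier → Mat₂ Carrier
  T M = mat₂ (- 1#) 0# M (- 1#)

  middle : Carrier → (X Z : Mat₂ Carrier) → Mat₂ Carrier
  middle M X Z = adj X · T M · adj Z

  S : Carrier → Mat₂ Carrier → Mat₂ Carrier
  S M Q = mat₂ s 0# (s * M) s
    where
    s : Carrier
    s = M * e₁₂ Q + - tr Q

module Monodromy {c ℓ} (R : CommutativeRing c ℓ) where

  open CommutativeRing R
  open RawMonodromy rawRing public
  open SpecialLinear R public
  open Algebra.Properties.AbelianGroup +-abelianGroup using (⁻¹-involutive; ⁻¹-selfInverse)
  open MarkovEquation R public
  open IntegerSolver R
  private
    module ≈-Reasoning = SetoidReasoning setoid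
    module ≈₂-Reasoning = SetoidReasoning ≈₂-setoid
  private module Poly {n : ℕ} where
    open RawMatrices (polynomialRing n) public
    open RawMonodromy (polynomialRing n) public
    open RawMarkov (polynomialRing n) public

  det-T : ∀ M → det (T M) ≈ 1#
  det-T = solve 1 (λ M → Poly.det (Poly.T M) := con 1ℤ) refl

  e₁₂-T·neg : ∀ M A → e₁₂ (T M · neg A) ≈ e₁₂ A
  e₁₂-T·neg M (mat₂ a b c d) = solve 5 (λ M a b c d →
    let A = mat₂ a b c d in e₁₂ (Poly.T M Poly.· Poly.neg A) := e₁₂ A) refl M a b c d

  e₁₂-neg·T : ∀ M A → e₁₂ (neg A · T M) ≈ e₁₂ A
  e₁₂-neg·T M (mat₂ a b c d) = solve 5 (λ M a b c d →
    let A = mat₂ a b c d in e₁₂ (Poly.neg A Poly.· Poly.T M) := e₁₂ A) refl M a b c d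

  tr-T·neg : ∀ M A {k} → tr A ≈ M * e₁₂ A - k → tr (T M · neg A) ≈ - k
  tr-T·neg M A@(mat₂ a b c d) {k} trA = begin
    tr (T M · neg A)               ≈⟨ solve 5 (λ M a b c d → let A = mat₂ a b c d in
                                        Poly.tr (Poly.T M Poly.· Poly.neg A) := Poly.tr A :- M :* e₁₂ A)
                                        refl M a b c d ⟩
    tr A - M * e₁₂ A               ≈⟨ +-congʳ trA ⟩
    M * e₁₂ A - k - M * e₁₂ A      ≈⟨ solve 2 (λ x k → x :- k :- x := :- k) refl (M * e₁₂ A) k ⟩
    - k                            ∎
    where open ≈-Reasoning

  -- S M Q = − s T⁻¹ with s = tr (T M · Q).
  T·[Q⊕S] : ∀ M Q → T M · (Q ⊕ S M Q) ≈₂ T M · Q ⊖ scalar (tr (T M · Q))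
  T·[Q⊕S] M (mat₂ a b c d) =
      solve 5 (λ M a b c d → let Q = mat₂ a b c d in e₁₁ (lhs M Q) := e₁₁ (rhs M Q)) refl M a b c d
    , solve 5 (λ M a b c d → let Q = mat₂ a b c d in e₁₂ (lhs M Q) := e₁₂ (rhs M Q)) refl M a b c d
    , solve 5 (λ M a b c d → let Q = mat₂ a b c d in e₂₁ (lhs M Q) := e₂₁ (rhs M Q)) refl M a b c d
    , solve 5 (λ M a b c d → let Q = mat₂ a b c d in e₂₂ (lhs M Q) := e₂₂ (rhs M Q)) refl M a b c d
    where
    lhs rhs : ∀ {n} → Polynomial n → Mat₂ (Polynomial n) → Mat₂ (Polynomial n)
    lhs M Q = Poly.T M Poly.· (Q Poly.⊕ Poly.S M Q)
    rhs M Q = Poly.T M Poly.· Q Poly.⊖ Poly.scalar (Poly.tr (Poly.T M Poly.· Q))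

  T·-P·-R≈adj[T·-Q] : ∀ {M P Q R} → Q ≈₂ P · R ⊖ S M Q → T M · (neg P · neg R) ≈₂ adj (T M · neg Q)
  T·-P·-R≈adj[T·-Q] {M} {P} {Q} {R} Q≈PR⊖S = begin
    T M · (neg P · neg R)                ≈⟨ ·-cong ≈₂-refl (neg·neg P R) ⟩
    T M · (P · R)                        ≈⟨ ·-cong ≈₂-refl (⊖-transpose Q≈PR⊖S) ⟩
    T M · (Q ⊕ S M Q)                    ≈⟨ T·[Q⊕S] M Q ⟩
    T M · Q ⊖ scalar (tr (T M · Q))      ≈⟨ cayley-hamilton (T M · Q) ⟩
    neg (adj (T M · Q))                  ≈⟨ adj-cong (·-negʳ (T M) Q) ⟨
    adj (T M · neg Q)                    ∎
    where open ≈₂-Reasoning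

  e₁₂-·-+-middle : ∀ M X Z →
    e₁₂ (X · Z) + e₁₂ (middle M X Z) ≈ M * (e₁₂ X * e₁₂ Z) + tr X * e₁₂ Z + tr Z * e₁₂ X
  e₁₂-·-+-middle M (mat₂ a b c d) (mat₂ e f g h) = solve 9 (λ M a b c d e f g h →
    let X = mat₂ a b c d ; Z = mat₂ e f g h in
    e₁₂ (X Poly.· Z) :+ e₁₂ (Poly.middle M X Z)
      := M :* (e₁₂ X :* e₁₂ Z) :+ Poly.tr X :* e₁₂ Z :+ Poly.tr Z :* e₁₂ X)
    refl M a b c d e f g h

  e₁₂-·-*-middle : ∀ M X Z → e₁₂ (X · Z) * e₁₂ (middle M X Z) ≈
    det Z * (e₁₂ X * e₁₂ X) + - tr (middle M X Z) * e₁₂ X * e₁₂ Z + det X * (e₁₂ Z * e₁₂ Z)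
  e₁₂-·-*-middle M (mat₂ a b c d) (mat₂ e f g h) = solve 9 (λ M a b c d e f g h →
    let X = mat₂ a b c d ; Z = mat₂ e f g h in
    e₁₂ (X Poly.· Z) :* e₁₂ (Poly.middle M X Z)
      := Poly.det Z :* (e₁₂ X :* e₁₂ X) :+ :- Poly.tr (Poly.middle M X Z) :* e₁₂ X :* e₁₂ Z
         :+ Poly.det X :* (e₁₂ Z :* e₁₂ Z))
    refl M a b c d e f g h

  open Group SL₂-group using (_∙_; _⁻¹) renaming (_≈_ to _≈ˢ_)
  open TripleFactorization SL₂-group

  Tˢ : Carrier → SL₂
  Tˢ M = T M # det-T M

  module MonodromyTriple {M : Carrier} (X Y Z : SL₂) (XYZ≈T : X ∙ Y ∙ Z ≈ˢ Tˢ M) where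

    private
      x y z b : Carrier
      x = e₁₂ (matrix X)
      y = e₁₂ (matrix Y)
      z = e₁₂ (matrix Z)
      b = e₁₂ (matrix X · matrix Z)

      Y′ : Mat₂ Carrier
      Y′ = middle M (matrix X) (matrix Z)

      Y≈middle : matrix Y ≈₂ Y′
      Y≈middle = middle-factor X Y Z {Tˢ M} XYZ≈T

    exchange : ∀ {l} → tr (matrix Y) ≈ - l → Exchange l b y x z
    exchange {l} trY = holds (begin
      b * y                                     ≈⟨ *-congˡ (proj₁ (proj₂ Y≈middle)) ⟩
      b * e₁₂ Y′                                ≈⟨ e₁₂-·-*-middle M (matrix X) (matrix Z) ⟩
      det (matrix Z) * (x * x) + - tr Y′ * x * z + det (matrix X) * (z * z)
        ≈⟨ +-cong (+-cong (*-congʳ (det≈1 Z)) (*-congʳ (*-congʳ -trY′≈l))) (*-congʳ (det≈1 X)) ⟩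
      1# * (x * x) + l * x * z + 1# * (z * z)
        ≈⟨ +-cong (+-congʳ (*-identityˡ (x * x))) (*-identityˡ (z * z)) ⟩
      exchangeForm l x z                        ∎)
      where
      open ≈-Reasoning
      -trY′≈l : - tr Y′ ≈ l
      -trY′≈l = ⁻¹-selfInverse (trans (sym trY) (tr-cong Y≈middle))

    sum : ∀ {k n} → tr (matrix X) ≈ - k → tr (matrix Z) ≈ - n → b + y ≈ M * (x * z) + - k * z + - n * x
    sum {k} {n} trX trZ = begin
      b + y                                     ≈⟨ +-congˡ (proj₁ (proj₂ Y≈middle)) ⟩
      b + e₁₂ Y′                                ≈⟨ e₁₂-·-+-middle M (matrix X) (matrix Z) ⟩
      M * (x * z) + tr (matrix X) * z + tr (matrix Z) * x
        ≈⟨ +-cong (+-congˡ (*-congʳ trX)) (*-congʳ trZ) ⟩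
      M * (x * z) + - k * z + - n * x           ∎
      where open ≈-Reasoning

    markov : ∀ {k l n} → tr (matrix X) ≈ - k → tr (matrix Y) ≈ - l → tr (matrix Z) ≈ - n → Markov M k l n x b z
    markov {k} {l} {n} trX trY trZ = holds (begin
      M * (x * b * z)
        ≈⟨ solve 6 (λ M k n x b z → M :* (x :* b :* z)
             := b :* (M :* (x :* z) :+ :- k :* z :+ :- n :* x) :+ (k :* (b :* z) :+ n :* (x :* b)))
             refl M k n x b z ⟩
      b * (M * (x * z) + - k * z + - n * x) + (k * (b * z) + n * (x * b))
        ≈⟨ +-congʳ (*-congˡ (sum trX trZ)) ⟨
      b * (b + y) + (k * (b * z) + n * (x * b))
        ≈⟨ +-congʳ (distribˡ b b y) ⟩
      b * b + b * y + (k * (b * z) + n * (x * b))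
        ≈⟨ +-congʳ (+-congˡ (Exchange.equation (exchange trY))) ⟩
      b * b + exchangeForm l x z + (k * (b * z) + n * (x * b))
        ≈⟨ solve 6 (λ k l n x b z → b :* b :+ Poly.exchangeForm l x z :+ (k :* (b :* z) :+ n :* (x :* b))
             := Poly.markovForm k l n x b z) refl k l n x b z ⟩
      markovForm k l n x b z ∎)
      where open ≈-Reasoning

  module Decomposition {M k l n a b c : Carrier} (P Q R : SL₂)
    (Q≈PR⊖S : matrix Q ≈₂ matrix P · matrix R ⊖ S M (matrix Q))
    (P₁₂≈a : e₁₂ (matrix P) ≈ a) (Q₁₂≈b : e₁₂ (matrix Q) ≈ b) (R₁₂≈c : e₁₂ (matrix R) ≈ c)
    (trP : tr (matrix P) ≈ M * e₁₂ (matrix P) - k)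
    (trQ : tr (matrix Q) ≈ M * e₁₂ (matrix Q) - l)
    (trR : tr (matrix R) ≈ M * e₁₂ (matrix R) - n)
    where

    private
      -P -Q -R : SL₂
      -P = negate P
      -Q = negate Q
      -R = negate R

    X Y Z : SL₂
    X = Tˢ M ∙ -P
    Y = (-R ∙ Tˢ M ∙ -P) ⁻¹
    Z = -R ∙ Tˢ M

    isFactorization : Factorization (Tˢ M) -P -Q -R X Y Z
    isFactorization = factorization (Tˢ M) -P -Q -R (T·-P·-R≈adj[T·-Q] Q≈PR⊖S)

    open Factorization isFactorization public using (XYZ≈T)
    open Factorization isFactorization using (P≈[YZ]⁻¹; Q≈[XZ]⁻¹; R≈[XY]⁻¹)

    P≈-[YZ]⁻¹ : matrix P ≈₂ neg (adj (matrix Y · matrix Z))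
    P≈-[YZ]⁻¹ = neg-transpose P≈[YZ]⁻¹

    Q≈-[XZ]⁻¹ : matrix Q ≈₂ neg (adj (matrix X · matrix Z))
    Q≈-[XZ]⁻¹ = neg-transpose Q≈[XZ]⁻¹

    R≈-[XY]⁻¹ : matrix R ≈₂ neg (adj (matrix X · matrix Y))
    R≈-[XY]⁻¹ = neg-transpose R≈[XY]⁻¹

    unique : ∀ X′ Y′ Z′ → X′ ∙ Y′ ∙ Z′ ≈ˢ Tˢ M →
      matrix P ≈₂ neg (adj (matrix Y′ · matrix Z′)) →
      matrix Q ≈₂ neg (adj (matrix X′ · matrix Z′)) →
      matrix R ≈₂ neg (adj (matrix X′ · matrix Y′)) →
      X′ ≈ˢ X × Y′ ≈ˢ Y × Z′ ≈ˢ Z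
    unique X′ Y′ Z′ XYZ≈T P≈ Q≈ R≈ = factorization-unique {Tˢ M} { -P } { -Q } { -R } {X′} {Y′} {Z′} (record
      { XYZ≈T = XYZ≈T
      ; P≈[YZ]⁻¹ = transpose-neg P≈
      ; Q≈[XZ]⁻¹ = transpose-neg Q≈
      ; R≈[XY]⁻¹ = transpose-neg R≈ })
      where
      transpose-neg : ∀ {A B} → A ≈₂ neg B → neg A ≈₂ B
      transpose-neg A≈-B = ≈₂-sym (neg-transpose (≈₂-sym A≈-B))

    X₁₂≈a : e₁₂ (matrix X) ≈ a
    X₁₂≈a = trans (e₁₂-T·neg M (matrix P)) P₁₂≈a

    Z₁₂≈c : e₁₂ (matrix Z) ≈ c
    Z₁₂≈c = trans (e₁₂-neg·T M (matrix R)) R₁₂≈c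

    [XZ]₁₂≈b : e₁₂ (matrix X · matrix Z) ≈ b
    [XZ]₁₂≈b = begin
      e₁₂ (matrix X · matrix Z)             ≈⟨ ⁻¹-involutive _ ⟨
      - - e₁₂ (matrix X · matrix Z)         ≈⟨ proj₁ (proj₂ Q≈-[XZ]⁻¹) ⟨
      e₁₂ (matrix Q)                        ≈⟨ Q₁₂≈b ⟩
      b                                     ∎
      where open ≈-Reasoning

    tr-X : tr (matrix X) ≈ - k
    tr-X = tr-T·neg M (matrix P) trP

    tr-Z : tr (matrix Z) ≈ - n
    tr-Z = trans (tr-·-comm (matrix -R) (T M)) (tr-T·neg M (matrix R) trR)

    tr-Y : tr (matrix Y) ≈ - l
    tr-Y = begin
      tr (matrix Y)                     ≈⟨ tr-adj (matrix (-R ∙ Tˢ M ∙ -P)) ⟩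
      tr (matrix (-R ∙ Tˢ M ∙ -P))      ≈⟨ tr-cong (·-assoc (matrix -R) (T M) (matrix -P)) ⟩
      tr (matrix (-R ∙ (Tˢ M ∙ -P)))    ≈⟨ tr-·-comm (matrix -R) (matrix (Tˢ M ∙ -P)) ⟩
      tr (matrix (Tˢ M ∙ -P ∙ -R))      ≈⟨ tr-cong (·-assoc (T M) (matrix -P) (matrix -R)) ⟩
      tr (matrix (Tˢ M ∙ (-P ∙ -R)))    ≈⟨ tr-cong (T·-P·-R≈adj[T·-Q] Q≈PR⊖S) ⟩
      tr (adj (matrix (Tˢ M ∙ -Q)))     ≈⟨ tr-adj (matrix (Tˢ M ∙ -Q)) ⟩
      tr (matrix (Tˢ M ∙ -Q))           ≈⟨ tr-T·neg M (matrix Q) trQ ⟩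
      - l                               ∎
      where open ≈-Reasoning

    private module XYZ = MonodromyTriple X Y Z XYZ≈T

    exchange : Exchange l b (e₁₂ (matrix Y)) a c
    exchange = exchange-cong [XZ]₁₂≈b refl X₁₂≈a Z₁₂≈c (XYZ.exchange tr-Y)

    markov : Markov M k l n a b c
    markov = markov-cong X₁₂≈a [XZ]₁₂≈b Z₁₂≈c (XYZ.markov tr-X tr-Y tr-Z)

open import Defs
open ≡ using (_≢_; refl; sym; trans; cong; cong₂; subst; module ≡-Reasoning)

one : Mono
one = mono 0ℤ 0ℤ 0ℤ

monoMul-comm : ∀ m n → monoMul m n ≡ monoMul n m
monoMul-comm (mono a b c) (mono a′ b′ c′) rewrite ℤ.+-comm a a′ | ℤ.+-comm b b′ | ℤ.+-comm c c′ = refl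

monoMul-assoc : ∀ l m n → monoMul (monoMul l m) n ≡ monoMul l (monoMul m n)
monoMul-assoc (mono a b c) (mono a′ b′ c′) (mono a″ b″ c″)
  rewrite ℤ.+-assoc a a′ a″ | ℤ.+-assoc b b′ b″ | ℤ.+-assoc c c′ c″ = refl

monoMul-identityˡ : ∀ m → monoMul one m ≡ m
monoMul-identityˡ (mono a b c) rewrite ℤ.+-identityˡ a | ℤ.+-identityˡ b | ℤ.+-identityˡ c = refl

monomialMonoid : RawMonoid 0ℓ 0ℓ
monomialMonoid = record { Carrier = Mono ; _≈_ = _≡_ ; _∙_ = monoMul ; ε = one }

sameMono-reflects : ∀ m n → Reflects (m ≡ n) (sameMono m n)
sameMono-reflects (mono a b c) (mono a′ b′ c′) with a ℤ.≟ a′ | b ℤ.≟ b′ | c ℤ.≟ c′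
... | yes refl | yes refl | yes refl = ofʸ refl
... | no a≢a′ | _ | _ = ofⁿ λ { refl → a≢a′ refl }
... | yes _ | no b≢b′ | _ = ofⁿ λ { refl → b≢b′ refl }
... | yes _ | yes _ | no c≢c′ = ofⁿ λ { refl → c≢c′ refl }

_≟_ : DecidableEquality Mono
m ≟ n = sameMono m n because sameMono-reflects m n

sameMono-refl : ∀ m → sameMono m m ≡ true
sameMono-refl m with sameMono m m | sameMono-reflects m m
... | true | _ = refl
... | false | ofⁿ m≢m = contradiction refl m≢m

-- On a duplicate-free list that contains the monomials of p this is a normal form of p, and it depends
-- on the coefficients of p only.
collect : List Mono → Laurent → Laurent
collect ms p = map (λ m → coeff p m , m) ms

collect-∉ : ∀ {n ms} c p → n ∉ ms → collect ms ((c , n) ∷ p) ≡ collect ms p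
collect-∉ {ms = []} c p n∉ms = refl
collect-∉ {n} {m ∷ ms} c p n∉ms with sameMono n m | sameMono-reflects n m
... | true | ofʸ n≡m = contradiction (here n≡m) n∉ms
... | false | _ = cong ((coeff p m , m) ∷_) (collect-∉ c p (n∉ms ∘ there))

module LinearExtension {c ℓ} (R : CommutativeRing c ℓ) where

  private module R = CommutativeRing R
  open IntegerMultiples R
  open IntegerSolver R
  open SetoidReasoning R.setoid
  open Algebra.Properties.Ring R.ring using (-1*x≈-x)
  open Algebra.Properties.CommutativeSemigroup R.+-commutativeSemigroup using (x∙yz≈y∙xz)

  ∑ : Laurent → (Mono → R.Carrier) → R.Carrier
  ∑ [] f = R.0#
  ∑ ((c , m) ∷ p) f = ι c R.* f m R.+ ∑ p f

  ∑-congʳ : ∀ p {f g} → (∀ m → f m R.≈ g m) → ∑ p f R.≈ ∑ p g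
  ∑-congʳ [] f≈g = R.refl
  ∑-congʳ ((c , m) ∷ p) f≈g = R.+-cong (R.*-congˡ (f≈g m)) (∑-congʳ p f≈g)

  ∑-+ : ∀ p q f → ∑ (p + q) f R.≈ ∑ p f R.+ ∑ q f
  ∑-+ [] q f = R.sym (R.+-identityˡ _)
  ∑-+ ((c , m) ∷ p) q f = R.trans (R.+-congˡ (∑-+ p q f)) (R.sym (R.+-assoc _ _ _))

  ∑-0 : ∀ p → ∑ p (const R.0#) R.≈ R.0#
  ∑-0 [] = R.refl
  ∑-0 ((c , m) ∷ p) = R.trans (R.+-cong (R.zeroʳ (ι c)) (∑-0 p)) (R.+-identityˡ R.0#)

  ∑-distrib-+ : ∀ p f g → ∑ p (λ m → f m R.+ g m) R.≈ ∑ p f R.+ ∑ p g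
  ∑-distrib-+ [] f g = R.sym (R.+-identityˡ R.0#)
  ∑-distrib-+ ((c , m) ∷ p) f g = begin
    ι c R.* (f m R.+ g m) R.+ ∑ p (λ m → f m R.+ g m)
      ≈⟨ R.+-congˡ (∑-distrib-+ p f g) ⟩
    ι c R.* (f m R.+ g m) R.+ (∑ p f R.+ ∑ p g)
      ≈⟨ solve 5 (λ c x y s t → c :* (x :+ y) :+ (s :+ t) := c :* x :+ s :+ (c :* y :+ t))
           R.refl (ι c) (f m) (g m) (∑ p f) (∑ p g) ⟩
    ι c R.* f m R.+ ∑ p f R.+ (ι c R.* g m R.+ ∑ p g) ∎

  *-distribˡ-∑ : ∀ p x f → ∑ p (λ m → x R.* f m) R.≈ x R.* ∑ p f
  *-distribˡ-∑ [] x f = R.sym (R.zeroʳ x)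
  *-distribˡ-∑ ((c , m) ∷ p) x f = begin
    ι c R.* (x R.* f m) R.+ ∑ p (λ m → x R.* f m)
      ≈⟨ R.+-congˡ (*-distribˡ-∑ p x f) ⟩
    ι c R.* (x R.* f m) R.+ x R.* ∑ p f
      ≈⟨ solve 4 (λ c x y s → c :* (x :* y) :+ x :* s := x :* (c :* y :+ s)) R.refl (ι c) x (f m) (∑ p f) ⟩
    x R.* (ι c R.* f m R.+ ∑ p f) ∎

  ∑-swap : ∀ p q (f : Mono → Mono → R.Carrier) → ∑ p (λ m → ∑ q (f m)) R.≈ ∑ q (λ n → ∑ p (λ m → f m n))
  ∑-swap [] q f = R.sym (∑-0 q)
  ∑-swap ((c , m) ∷ p) q f = begin
    ι c R.* ∑ q (f m) R.+ ∑ p (λ m → ∑ q (f m))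
      ≈⟨ R.+-cong (R.sym (*-distribˡ-∑ q (ι c) (f m))) (∑-swap p q f) ⟩
    ∑ q (λ n → ι c R.* f m n) R.+ ∑ q (λ n → ∑ p (λ m → f m n))
      ≈⟨ ∑-distrib-+ q _ _ ⟨
    ∑ q (λ n → ∑ ((c , m) ∷ p) (λ m → f m n)) ∎

  ∑-map : ∀ {h g} c → (∀ d n → h (d , n) ≡ (c ℤ.* d , g n)) → ∀ q f → ∑ (map h q) f R.≈ ι c R.* ∑ q (f ∘ g)
  ∑-map c h≡ [] f = R.sym (R.zeroʳ (ι c))
  ∑-map {h} {g} c h≡ ((d , n) ∷ q) f rewrite h≡ d n = begin
    ι (c ℤ.* d) R.* f (g n) R.+ ∑ (map h q) f
      ≈⟨ R.+-cong (R.*-congʳ (ι-* c d)) (∑-map c h≡ q f) ⟩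
    ι c R.* ι d R.* f (g n) R.+ ι c R.* ∑ q (f ∘ g)
      ≈⟨ solve 4 (λ c d y s → c :* d :* y :+ c :* s := c :* (d :* y :+ s))
           R.refl (ι c) (ι d) (f (g n)) (∑ q (f ∘ g)) ⟩
    ι c R.* (ι d R.* f (g n) R.+ ∑ q (f ∘ g)) ∎

  ∑-neg : ∀ p f → ∑ (- p) f R.≈ R.- ∑ p f
  ∑-neg p f = R.trans (∑-map ℤ.-1ℤ (λ d n → cong (_, n) (sym (ℤ.-1*i≡-i d))) p f) (-1*x≈-x (∑ p f))

  ∑-* : ∀ p q f → ∑ (p * q) f R.≈ ∑ p (λ m → ∑ q (f ∘ monoMul m))
  ∑-* [] q f = R.refl
  ∑-* ((c , m) ∷ p) q f = R.trans (∑-+ (map _ q) (p * q) f) (R.+-cong (∑-map c (λ _ _ → refl) q f) (∑-* p q f))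

  ∑-collect-[] : ∀ ms f → ∑ (collect ms []) f R.≈ R.0#
  ∑-collect-[] [] f = R.refl
  ∑-collect-[] (m ∷ ms) f = R.trans (R.+-cong (R.zeroˡ (f m)) (∑-collect-[] ms f)) (R.+-identityˡ R.0#)

  ∑-collect-∷ : ∀ {n ms} c p f → Unique ms → n ∈ ms →
    ∑ (collect ms ((c , n) ∷ p)) f R.≈ ι c R.* f n R.+ ∑ (collect ms p) f
  ∑-collect-∷ {n} {.n ∷ ms} c p f (n∉ms ∷ _) (here refl)
    rewrite sameMono-refl n | collect-∉ {n} {ms} c p (All¬⇒¬Any n∉ms) = begin
    ι (c ℤ.+ coeff p n) R.* f n R.+ ∑ (collect ms p) f
      ≈⟨ R.+-congʳ (R.*-congʳ (ι-+ c (coeff p n))) ⟩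
    (ι c R.+ ι (coeff p n)) R.* f n R.+ ∑ (collect ms p) f
      ≈⟨ solve 4 (λ c d y s → (c :+ d) :* y :+ s := c :* y :+ (d :* y :+ s))
           R.refl (ι c) (ι (coeff p n)) (f n) _ ⟩
    ι c R.* f n R.+ (ι (coeff p n) R.* f n R.+ ∑ (collect ms p) f) ∎
  ∑-collect-∷ {n} {m ∷ ms} c p f (m∉ms ∷ unique) (there n∈ms) with sameMono n m | sameMono-reflects n m
  ... | true | ofʸ refl = contradiction n∈ms (All¬⇒¬Any m∉ms)
  ... | false | _ = begin
    ι (coeff p m) R.* f m R.+ ∑ (collect ms ((c , n) ∷ p)) f
      ≈⟨ R.+-congˡ (∑-collect-∷ c p f unique n∈ms) ⟩
    ι (coeff p m) R.* f m R.+ (ι c R.* f n R.+ ∑ (collect ms p) f)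
      ≈⟨ x∙yz≈y∙xz _ _ _ ⟩
    ι c R.* f n R.+ (ι (coeff p m) R.* f m R.+ ∑ (collect ms p) f) ∎

  ∑-collect : ∀ {ms} p f → Unique ms → All (λ t → proj₂ t ∈ ms) p → ∑ (collect ms p) f R.≈ ∑ p f
  ∑-collect {ms} [] f unique [] = ∑-collect-[] ms f
  ∑-collect ((c , n) ∷ p) f unique (n∈ms ∷ p⊆ms) =
    R.trans (∑-collect-∷ c p f unique n∈ms) (R.+-congˡ (∑-collect p f unique p⊆ms))

  ∑-congˡ : ∀ p q → p ≈ q → ∀ f → ∑ p f R.≈ ∑ q f
  ∑-congˡ p q p≈q f = begin
    ∑ p f                 ≈⟨ ∑-collect p f unique (All.tabulate (∈-support ∘ ∈-++⁺ˡ)) ⟨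
    ∑ (collect ms p) f    ≡⟨ cong (λ s → ∑ s f) (map-cong (λ m → cong (_, m) (p≈q m)) ms) ⟩
    ∑ (collect ms q) f    ≈⟨ ∑-collect q f unique (All.tabulate (∈-support ∘ ∈-++⁺ʳ p)) ⟩
    ∑ q f                 ∎
    where
    ms : List Mono
    ms = deduplicate _≟_ (map proj₂ (p ++ q))
    unique : Unique ms
    unique = deduplicate-! _≟_ (map proj₂ (p ++ q))
    ∈-support : ∀ {t} → t ∈ p ++ q → proj₂ t ∈ ms
    ∈-support = ∈-deduplicate⁺ _≟_ ∘ ∈-map⁺ proj₂

module LaurentRing where

  open LinearExtension ℤ.+-*-commutativeRing
  open IntegerMultiples ℤ.+-*-commutativeRing using (ι; ι-+; additive-unique)
  open ≡-Reasoning

  ι≡id : ∀ i → ι i ≡ i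
  ι≡id = additive-unique {ι} {id} ι-+ (λ _ _ → refl) refl

  δ : Mono → Mono → ℤ
  δ m n = if sameMono n m then 1ℤ else 0ℤ

  coeff-∑ : ∀ p m → coeff p m ≡ ∑ p (δ m)
  coeff-∑ [] m = refl
  coeff-∑ ((c , n) ∷ p) m rewrite ι≡id c with sameMono n m
  ... | true = cong₂ ℤ._+_ (sym (ℤ.*-identityʳ c)) (coeff-∑ p m)
  ... | false = trans (coeff-∑ p m) (sym (trans (cong (ℤ._+ _) (ℤ.*-zeroʳ c)) (ℤ.+-identityˡ _)))

  ∑-injective : ∀ p q → (∀ f → ∑ p f ≡ ∑ q f) → p ≈ q
  ∑-injective p q ∑p≡∑q m = trans (coeff-∑ p m) (trans (∑p≡∑q (δ m)) (sym (coeff-∑ q m)))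

  ≈-setoid : Setoid 0ℓ 0ℓ
  ≈-setoid = record
    { Carrier = Laurent ; _≈_ = _≈_
    ; isEquivalence = record
      { refl = λ _ → refl
      ; sym = λ p≈q m → sym (p≈q m)
      ; trans = λ p≈q q≈r m → trans (p≈q m) (q≈r m) } }

  +-cong : ∀ p p′ q q′ → p ≈ p′ → q ≈ q′ → p + q ≈ p′ + q′
  +-cong p p′ q q′ p≈p′ q≈q′ = ∑-injective (p + q) (p′ + q′) λ f → begin
    ∑ (p + q) f              ≡⟨ ∑-+ p q f ⟩
    ∑ p f ℤ.+ ∑ q f          ≡⟨ cong₂ ℤ._+_ (∑-congˡ p p′ p≈p′ f) (∑-congˡ q q′ q≈q′ f) ⟩
    ∑ p′ f ℤ.+ ∑ q′ f        ≡⟨ ∑-+ p′ q′ f ⟨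
    ∑ (p′ + q′) f            ∎

  +-comm : ∀ p q → p + q ≈ q + p
  +-comm p q = ∑-injective (p + q) (q + p) λ f → begin
    ∑ (p + q) f              ≡⟨ ∑-+ p q f ⟩
    ∑ p f ℤ.+ ∑ q f          ≡⟨ ℤ.+-comm (∑ p f) (∑ q f) ⟩
    ∑ q f ℤ.+ ∑ p f          ≡⟨ ∑-+ q p f ⟨
    ∑ (q + p) f              ∎

  -‿cong : ∀ p q → p ≈ q → - p ≈ - q
  -‿cong p q p≈q = ∑-injective (- p) (- q) λ f → begin
    ∑ (- p) f                ≡⟨ ∑-neg p f ⟩
    ℤ.- ∑ p f                ≡⟨ cong ℤ.-_ (∑-congˡ p q p≈q f) ⟩
    ℤ.- ∑ q f                ≡⟨ ∑-neg q f ⟨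
    ∑ (- q) f                ∎

  -‿inverseʳ : ∀ p → p - p ≈ zeroL
  -‿inverseʳ p = ∑-injective (p - p) zeroL λ f → begin
    ∑ (p - p) f              ≡⟨ ∑-+ p (- p) f ⟩
    ∑ p f ℤ.+ ∑ (- p) f      ≡⟨ cong (λ s → ∑ p f ℤ.+ s) (∑-neg p f) ⟩
    ∑ p f ℤ.- ∑ p f          ≡⟨ ℤ.+-inverseʳ (∑ p f) ⟩
    0ℤ                       ∎

  *-cong : ∀ p p′ q q′ → p ≈ p′ → q ≈ q′ → p * q ≈ p′ * q′
  *-cong p p′ q q′ p≈p′ q≈q′ = ∑-injective (p * q) (p′ * q′) λ f → begin
    ∑ (p * q) f                                  ≡⟨ ∑-* p q f ⟩
    ∑ p (λ m → ∑ q (f ∘ monoMul m))              ≡⟨ ∑-congʳ p (λ m → ∑-congˡ q q′ q≈q′ (f ∘ monoMul m)) ⟩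
    ∑ p (λ m → ∑ q′ (f ∘ monoMul m))             ≡⟨ ∑-congˡ p p′ p≈p′ _ ⟩
    ∑ p′ (λ m → ∑ q′ (f ∘ monoMul m))            ≡⟨ ∑-* p′ q′ f ⟨
    ∑ (p′ * q′) f                                ∎

  *-comm : ∀ p q → p * q ≈ q * p
  *-comm p q = ∑-injective (p * q) (q * p) λ f → begin
    ∑ (p * q) f                                  ≡⟨ ∑-* p q f ⟩
    ∑ p (λ m → ∑ q (λ n → f (monoMul m n)))      ≡⟨ ∑-swap p q _ ⟩
    ∑ q (λ n → ∑ p (λ m → f (monoMul m n)))
      ≡⟨ ∑-congʳ q (λ n → ∑-congʳ p (λ m → cong f (monoMul-comm m n))) ⟩
    ∑ q (λ n → ∑ p (λ m → f (monoMul n m)))      ≡⟨ ∑-* q p f ⟨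
    ∑ (q * p) f                                  ∎

  *-assoc : ∀ p q r → p * q * r ≈ p * (q * r)
  *-assoc p q r = ∑-injective (p * q * r) (p * (q * r)) λ f → begin
    ∑ (p * q * r) f                           ≡⟨ ∑-* (p * q) r f ⟩
    ∑ (p * q) (λ l → ∑ r (f ∘ monoMul l))     ≡⟨ ∑-* p q _ ⟩
    ∑ p (λ m → ∑ q (λ n → ∑ r (λ l → f (monoMul (monoMul m n) l))))
      ≡⟨ ∑-congʳ p (λ m → ∑-congʳ q (λ n → ∑-congʳ r (λ l → cong f (monoMul-assoc m n l)))) ⟩
    ∑ p (λ m → ∑ q (λ n → ∑ r (λ l → f (monoMul m (monoMul n l)))))
      ≡⟨ ∑-congʳ p (λ m → ∑-* q r (f ∘ monoMul m)) ⟨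
    ∑ p (λ m → ∑ (q * r) (f ∘ monoMul m))     ≡⟨ ∑-* p (q * r) f ⟨
    ∑ (p * (q * r)) f                         ∎

  *-identityˡ : ∀ p → cst 1ℤ * p ≈ p
  *-identityˡ p = ∑-injective (cst 1ℤ * p) p λ f → begin
    ∑ (cst 1ℤ * p) f                         ≡⟨ ∑-* (cst 1ℤ) p f ⟩
    1ℤ ℤ.* ∑ p (f ∘ monoMul one) ℤ.+ 0ℤ      ≡⟨ trans (ℤ.+-identityʳ _) (ℤ.*-identityˡ _) ⟩
    ∑ p (f ∘ monoMul one)                    ≡⟨ ∑-congʳ p (λ m → cong f (monoMul-identityˡ m)) ⟩
    ∑ p f                                    ∎

  *-distribʳ-+ : ∀ p q r → (q + r) * p ≈ q * p + r * p
  *-distribʳ-+ p q r = ∑-injective ((q + r) * p) (q * p + r * p) λ f → begin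
    ∑ ((q + r) * p) f                         ≡⟨ ∑-* (q + r) p f ⟩
    ∑ (q + r) (λ m → ∑ p (f ∘ monoMul m))     ≡⟨ ∑-+ q r _ ⟩
    ∑ q (λ m → ∑ p (f ∘ monoMul m)) ℤ.+ ∑ r (λ m → ∑ p (f ∘ monoMul m))
      ≡⟨ cong₂ ℤ._+_ (∑-* q p f) (∑-* r p f) ⟨
    ∑ (q * p) f ℤ.+ ∑ (r * p) f               ≡⟨ ∑-+ (q * p) (r * p) f ⟨
    ∑ (q * p + r * p) f                       ∎

  laurentRing : CommutativeRing 0ℓ 0ℓ
  laurentRing = record
    { Carrier = Laurent ; _≈_ = _≈_ ; _+_ = _+_ ; _*_ = _*_ ; -_ = -_ ; 0# = zeroL ; 1# = cst 1ℤ
    ; isCommutativeRing = record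
      { isRing = record
        { +-isAbelianGroup = record
          { isGroup = record
            { isMonoid = record
              { isSemigroup = record
                { isMagma = record
                  { isEquivalence = Setoid.isEquivalence ≈-setoid
                  ; ∙-cong = λ {p} {p′} {q} {q′} → +-cong p p′ q q′ }
                ; assoc = λ p q r m → cong (λ s → coeff s m) (++-assoc p q r) }
              ; identity = comm∧idˡ⇒id {_+_} +-comm {zeroL} (λ _ _ → refl) }
            ; inverse = comm∧invʳ⇒inv {_+_} { -_ } {zeroL} +-comm -‿inverseʳ
            ; ⁻¹-cong = λ {p} {q} → -‿cong p q }
          ; comm = +-comm }
        ; *-cong = λ {p} {p′} {q} {q′} → *-cong p p′ q q′
        ; *-assoc = *-assoc
        ; *-identity = comm∧idˡ⇒id {_*_} *-comm {cst 1ℤ} *-identityˡ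
        ; distrib = comm∧distrʳ⇒distr {_*_} {_+_} (λ {p} {p′} {q} {q′} → +-cong p p′ q q′) *-comm *-distribʳ-+ }
      ; *-comm = *-comm } }
    where open Algebra.Consequences.Setoid ≈-setoid using (comm∧idˡ⇒id; comm∧invʳ⇒inv; comm∧distrʳ⇒distr)

open LaurentRing using (laurentRing)

module Evaluation {c ℓ} (R : CommutativeRing c ℓ) where

  private module R = CommutativeRing R
  open LinearExtension R
  open IntegerMultiples R
  open IntegerPower R.*-commutativeMonoid
  open IntegerSolver R
  open SetoidReasoning R.setoid

  IsCharacter : (Mono → R.Carrier) → Set ℓ
  IsCharacter = IsMonoidHomomorphism monomialMonoid R.*-rawMonoid

  module Character {χ : Mono → R.Carrier} (isCharacter : IsCharacter χ) where

    private module χ = IsMonoidHomomorphism isCharacter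

    eval : Laurent → R.Carrier
    eval p = ∑ p χ

    eval-cst : ∀ i → eval (cst i) R.≈ ι i
    eval-cst i = R.trans (R.+-identityʳ _) (R.trans (R.*-congˡ χ.ε-homo) (R.*-identityʳ (ι i)))

    eval-* : ∀ p q → eval (p * q) R.≈ eval p R.* eval q
    eval-* p q = begin
      ∑ (p * q) χ                                ≈⟨ ∑-* p q χ ⟩
      ∑ p (λ m → ∑ q (λ n → χ (monoMul m n)))    ≈⟨ ∑-congʳ p (λ m → ∑-congʳ q (χ.homo m)) ⟩
      ∑ p (λ m → ∑ q (λ n → χ m R.* χ n))        ≈⟨ ∑-congʳ p (λ m → *-distribˡ-∑ q (χ m) χ) ⟩
      ∑ p (λ m → χ m R.* eval q)                 ≈⟨ ∑-congʳ p (λ m → R.*-comm (χ m) (eval q)) ⟩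
      ∑ p (λ m → eval q R.* χ m)                 ≈⟨ *-distribˡ-∑ p (eval q) χ ⟩
      eval q R.* eval p                          ≈⟨ R.*-comm (eval q) (eval p) ⟩
      eval p R.* eval q                          ∎

    eval-isRingHomomorphism : IsRingHomomorphism (CommutativeRing.rawRing laurentRing) R.rawRing eval
    eval-isRingHomomorphism = record
      { isSemiringHomomorphism = record
        { isNearSemiringHomomorphism = record
          { +-isMonoidHomomorphism = record
            { isMagmaHomomorphism = record
              { isRelHomomorphism = record { cong = λ {p} {q} p≈q → ∑-congˡ p q p≈q χ }
              ; homo = λ p q → ∑-+ p q χ }
            ; ε-homo = R.refl }
          ; *-homo = eval-* }
        ; 1#-homo = eval-cst 1ℤ }
      ; -‿homo = λ p → ∑-neg p χ }

    open MarkovMorphism laurentRing R eval-isRingHomomorphism public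

  module TorusPoint {u u⁻¹ v v⁻¹ w w⁻¹}
    (uu⁻¹≈1 : u R.* u⁻¹ R.≈ R.1#) (vv⁻¹≈1 : v R.* v⁻¹ R.≈ R.1#) (ww⁻¹≈1 : w R.* w⁻¹ R.≈ R.1#) where

    private
      U V W : ℤ → R.Carrier
      U = power uu⁻¹≈1
      V = power vv⁻¹≈1
      W = power ww⁻¹≈1

    character : Mono → R.Carrier
    character (mono i j l) = U i R.* V j R.* W l

    character-* : ∀ m n → character (monoMul m n) R.≈ character m R.* character n
    character-* (mono i j l) (mono i′ j′ l′) = begin
      U (i ℤ.+ i′) R.* V (j ℤ.+ j′) R.* W (l ℤ.+ l′)
        ≈⟨ R.*-cong (R.*-cong (power-+ uu⁻¹≈1 i i′) (power-+ vv⁻¹≈1 j j′)) (power-+ ww⁻¹≈1 l l′) ⟩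
      U i R.* U i′ R.* (V j R.* V j′) R.* (W l R.* W l′)
        ≈⟨ solve 6 (λ x x′ y y′ z z′ → x :* x′ :* (y :* y′) :* (z :* z′) := x :* y :* z :* (x′ :* y′ :* z′))
             R.refl (U i) (U i′) (V j) (V j′) (W l) (W l′) ⟩
      U i R.* V j R.* W l R.* (U i′ R.* V j′ R.* W l′) ∎

    isCharacter : IsCharacter character
    isCharacter = record
      { isMagmaHomomorphism = record
        { isRelHomomorphism = record { cong = λ { refl → R.refl } }
        ; homo = character-* }
      ; ε-homo = R.trans (R.*-identityʳ _) (R.*-identityʳ R.1#) }

    open Character isCharacter public

    eval-x₁ : eval x₁ R.≈ u
    eval-x₁ = solve 1 (λ u → con 1ℤ :* (u :* con 1ℤ :* con 1ℤ) :+ con 0ℤ := u) R.refl u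

    eval-x₂ : eval x₂ R.≈ v
    eval-x₂ = solve 1 (λ v → con 1ℤ :* (con 1ℤ :* v :* con 1ℤ) :+ con 0ℤ := v) R.refl v

    eval-x₃ : eval x₃ R.≈ w
    eval-x₃ = solve 1 (λ w → con 1ℤ :* (con 1ℤ :* con 1ℤ :* w) :+ con 0ℤ := w) R.refl w

module PositiveRationals where

  open IntegerMultiples ℚ.+-*-commutativeRing using (ι; ι-+)
  open MarkovEquation ℚ.+-*-commutativeRing using (exchangeForm)

  κℚ : ℕ → ℚ
  κℚ k = ι (+ k)

  κℚ-suc : ∀ k → κℚ (suc k) ≡ 1ℚ ℚ.+ κℚ k
  κℚ-suc k = ι-+ 1ℤ (+ k)

  κℚ-nonNegative : ∀ k → NonNegative (κℚ k)
  κℚ-nonNegative zero = _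
  κℚ-nonNegative (suc k) = subst NonNegative (sym (κℚ-suc k))
    (ℚ.nonNeg+nonNeg⇒nonNeg 1ℚ (κℚ k) {{κℚ-nonNegative k}})

  κℚ-suc≢0 : ∀ k → κℚ (suc k) ≢ 0ℚ
  κℚ-suc≢0 k κ≡0 = subst Positive (trans (sym (κℚ-suc k)) κ≡0)
    (ℚ.pos+nonNeg⇒pos 1ℚ (κℚ k) {{κℚ-nonNegative k}}) .ℤ.Positive.pos

  κℚ-injective : ∀ k l → κℚ k ≡ κℚ l → k ≡ l
  κℚ-injective zero zero _ = refl
  κℚ-injective zero (suc l) κ≡ = contradiction (sym κ≡) (κℚ-suc≢0 l)
  κℚ-injective (suc k) zero κ≡ = contradiction κ≡ (κℚ-suc≢0 k)
  κℚ-injective (suc k) (suc l) κ≡ = cong suc (κℚ-injective k l (∙-cancelˡ 1ℚ _ _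
    (trans (sym (κℚ-suc k)) (trans κ≡ (κℚ-suc l)))))
    where open Algebra.Properties.Group ℚ.+-0-group using (∙-cancelˡ)

  *-cancelˡ-pos : ∀ u → .{{Positive u}} → ∀ {x y} → u ℚ.* x ≡ u ℚ.* y → x ≡ y
  *-cancelˡ-pos u ux≡uy = ℚ.≤-antisym
    (ℚ.*-cancelˡ-≤-pos u (ℚ.≤-reflexive ux≡uy)) (ℚ.*-cancelˡ-≤-pos u (ℚ.≤-reflexive (sym ux≡uy)))

  exchangeForm-positive : ∀ k v w → .{{NonNegative k}} → .{{Positive v}} → .{{Positive w}} →
    Positive (exchangeForm k v w)
  exchangeForm-positive k v w = ℚ.nonNeg+pos⇒pos (v ℚ.* v ℚ.+ k ℚ.* v ℚ.* w) (w ℚ.* w)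
    where
    instance
      _ : NonNegative v
      _ = ℚ.pos⇒nonNeg v
      _ : NonNegative w
      _ = ℚ.pos⇒nonNeg w
      _ : Positive (w ℚ.* w)
      _ = ℚ.pos*pos⇒pos w w
      _ : NonNegative (v ℚ.* v)
      _ = ℚ.nonNeg*nonNeg⇒nonNeg v v
      _ : NonNegative (k ℚ.* v)
      _ = ℚ.nonNeg*nonNeg⇒nonNeg k v
      _ : NonNegative (k ℚ.* v ℚ.* w)
      _ = ℚ.nonNeg*nonNeg⇒nonNeg (k ℚ.* v) w
      _ : NonNegative (v ℚ.* v ℚ.+ k ℚ.* v ℚ.* w)
      _ = ℚ.nonNeg+nonNeg⇒nonNeg (v ℚ.* v) (k ℚ.* v ℚ.* w)

module Charts (M : Laurent) where

  open PositiveRationals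
  open MarkovEquation ℚ.+-*-commutativeRing
  open Evaluation ℚ.+-*-commutativeRing
  private module L = MarkovEquation laurentRing

  -- The Markov equation is recorded for the values only: in ℚ, unlike in the Laurent ring, it is
  -- plain that cluster variables can be cancelled, which its transport through a mutation requires.
  record Realization (k l n : ℕ) (a b c : Laurent) (u v w : ℚ) : Set where
    constructor realization
    field
      {χ} : Mono → ℚ
      isCharacter : IsCharacter χ
    open Character isCharacter
    field
      a↦u : eval a ≡ u
      b↦v : eval b ≡ v
      c↦w : eval c ≡ w
      markov : Markov (eval M) (κℚ k) (κℚ l) (κℚ n) u v w

  Chart : (k l n : ℕ) (a b c : Laurent) → Set
  Chart k l n a b c =
    ∀ u v w → .{{Positive u}} → .{{Positive v}} → .{{Positive w}} → Realization k l n a b c u v w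

  chart-swap₁₂ : ∀ {k l n a b c} → Chart k l n a b c → Chart l k n b a c
  chart-swap₁₂ chart v u w = realization isCharacter b↦v a↦u c↦w (markov-swap₁₂ markov)
    where open Realization (chart u v w)

  chart-swap₂₃ : ∀ {k l n a b c} → Chart k l n a b c → Chart k n l a c b
  chart-swap₂₃ chart u w v = realization isCharacter a↦u c↦w b↦v (markov-swap₂₃ markov)
    where open Realization (chart u v w)

  chart-mutate₁ : ∀ {k l n a a′ b c} → L.Exchange (κ k) a a′ b c → Chart k l n a b c → Chart k l n a′ b c
  chart-mutate₁ {k} {a′ = a′} exchange chart u v w =
    -- Where the old cluster has the values (N / u, v, w), the new one has the values (u, v, w).
    realization isCharacter a′↦u b↦v c↦w (markov-vieta (*-cancelˡ-pos u′) (holds u′u≡N) markov)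
    where
    N : ℚ
    N = exchangeForm (κℚ k) v w
    instance
      _ : ℚ.NonZero u
      _ = ℚ.pos⇒nonZero u
      _ : Positive (1/ u)
      _ = ℚ.1/pos⇒pos u
      _ : Positive N
      _ = exchangeForm-positive (κℚ k) v w {{κℚ-nonNegative k}}
    u′ : ℚ
    u′ = N ℚ.* 1/ u
    instance
      _ : Positive u′
      _ = ℚ.pos*pos⇒pos N (1/ u)
    u′u≡N : u′ ℚ.* u ≡ N
    u′u≡N = begin
      N ℚ.* 1/ u ℚ.* u       ≡⟨ ℚ.*-assoc N (1/ u) u ⟩
      N ℚ.* (1/ u ℚ.* u)     ≡⟨ cong (N ℚ.*_) (ℚ.*-inverseˡ u) ⟩
      N ℚ.* 1ℚ               ≡⟨ ℚ.*-identityʳ N ⟩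
      N                      ∎
      where open ≡-Reasoning
    open Realization (chart u′ v w)
    open Character isCharacter
    evaluated : Exchange (κℚ k) u′ (eval a′) v w
    evaluated = exchange-map (eval-cst (+ k)) a↦u refl b↦v c↦w exchange
    a′↦u : eval a′ ≡ u
    a′↦u = *-cancelˡ-pos u′ (trans (Exchange.equation evaluated) (sym u′u≡N))

  chart-markovForm : ∀ {k l n k′ l′ n′ a b c} → Chart k l n a b c → L.Markov M (κ k′) (κ l′) (κ n′) a b c →
    ∀ u v w → .{{Positive u}} → .{{Positive v}} → .{{Positive w}} →
    markovForm (κℚ k) (κℚ l) (κℚ n) u v w ≡ markovForm (κℚ k′) (κℚ l′) (κℚ n′) u v w
  chart-markovForm {k′ = k′} {l′} {n′} chart markovᴸ u v w =
    trans (sym (Markov.equation markov)) (Markov.equation evaluated)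
    where
    open Realization (chart u v w)
    open Character isCharacter
    evaluated : Markov (eval M) (κℚ k′) (κℚ l′) (κℚ n′) u v w
    evaluated = markov-map (eval-cst (+ k′)) (eval-cst (+ l′)) (eval-cst (+ n′)) a↦u b↦v c↦w markovᴸ

  chart-middle : ∀ {k l n k′ l′ n′ a b c} → Chart k l n a b c → L.Markov M (κ k′) (κ l′) (κ n′) a b c → l ≡ l′
  chart-middle {k} {l} {n} {k′} {l′} {n′} chart markov = κℚ-injective l l′ (begin
    κℚ l                                                 ≡⟨ markovForm-middle (κℚ k) (κℚ l) (κℚ n) ⟩
    2ℚ ℚ.* F k l n 1ℚ 1ℚ 1ℚ ℚ.- F k l n 1ℚ 2ℚ 1ℚ         ≡⟨ cong₂ (λ x y → 2ℚ ℚ.* x ℚ.- y)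
                                                              (agree 1ℚ 1ℚ 1ℚ) (agree 1ℚ 2ℚ 1ℚ) ⟩
    2ℚ ℚ.* F k′ l′ n′ 1ℚ 1ℚ 1ℚ ℚ.- F k′ l′ n′ 1ℚ 2ℚ 1ℚ   ≡⟨ markovForm-middle (κℚ k′) (κℚ l′) (κℚ n′) ⟨
    κℚ l′                                                ∎)
    where
    open ≡-Reasoning
    2ℚ : ℚ
    2ℚ = 1ℚ ℚ.+ 1ℚ
    F : (k l n : ℕ) (u v w : ℚ) → ℚ
    F k l n = markovForm (κℚ k) (κℚ l) (κℚ n)
    agree : ∀ u v w → .{{Positive u}} → .{{Positive v}} → .{{Positive w}} → F k l n u v w ≡ F k′ l′ n′ u v w
    agree = chart-markovForm chart markov

module Clusters (k₁ k₂ k₃ : ℕ) where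

  open Charts (𝓜 k₁ k₂ k₃)
  open MarkovEquation laurentRing

  markov-initial : Markov (𝓜 k₁ k₂ k₃) (κ k₁) (κ k₂) (κ k₃) x₁ x₂ x₃
  markov-initial = markov-quotient {κ k₁} {κ k₂} {κ k₃} {x₁} {x₂} {x₃} {x123⁻¹} (λ _ → refl)

  chart-initial : ∀ {a b c} → a ≈ x₁ → b ≈ x₂ → c ≈ x₃ → Chart k₁ k₂ k₃ a b c
  chart-initial {a} {b} {c} a≈x₁ b≈x₂ c≈x₃ u v w = realization isCharacter
    (trans (⟦⟧-cong {a} {x₁} a≈x₁) eval-x₁)
    (trans (⟦⟧-cong {b} {x₂} b≈x₂) eval-x₂)
    (trans (⟦⟧-cong {c} {x₃} c≈x₃) eval-x₃)
    (markov-map (eval-cst (+ k₁)) (eval-cst (+ k₂)) (eval-cst (+ k₃)) eval-x₁ eval-x₂ eval-x₃ markov-initial)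
    where
    instance
      _ : ℚ.NonZero u
      _ = ℚ.pos⇒nonZero u
      _ : ℚ.NonZero v
      _ = ℚ.pos⇒nonZero v
      _ : ℚ.NonZero w
      _ = ℚ.pos⇒nonZero w
    open Evaluation ℚ.+-*-commutativeRing
    open TorusPoint {u} {1/ u} {v} {1/ v} {w} {1/ w} (ℚ.*-inverseʳ u) (ℚ.*-inverseʳ v) (ℚ.*-inverseʳ w)
    open IsRingHomomorphism eval-isRingHomomorphism using (⟦⟧-cong)

  chart-labeled : ∀ {a b c} → Labeled k₁ k₂ k₃ a b c → Chart k₁ k₂ k₃ a b c
  chart-labeled (base a≈x₁ b≈x₂ c≈x₃) = chart-initial a≈x₁ b≈x₂ c≈x₃
  chart-labeled (mut₁ L eq) = chart-mutate₁ (holds eq) (chart-labeled L)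
  chart-labeled (mut₂ L eq) = chart-swap₁₂ (chart-mutate₁ (holds eq) (chart-swap₁₂ (chart-labeled L)))
  chart-labeled (mut₃ L eq) =
    chart-swap₂₃ (chart-swap₁₂ (chart-mutate₁ (holds eq) (chart-swap₁₂ (chart-swap₂₃ (chart-labeled L)))))

  parity-resp : ∀ {y z k} → y ≈ z → Parity k₁ k₂ k₃ y k → Parity k₁ k₂ k₃ z k
  parity-resp y≈z (pos₁ L y≈a) = pos₁ L λ m → trans (sym (y≈z m)) (y≈a m)
  parity-resp y≈z (pos₂ L y≈b) = pos₂ L λ m → trans (sym (y≈z m)) (y≈b m)
  parity-resp y≈z (pos₃ L y≈c) = pos₃ L λ m → trans (sym (y≈z m)) (y≈c m)

  labeled-resp : ∀ {a b c a′ b′ c′} → a ≈ a′ → b ≈ b′ → c ≈ c′ →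
    Labeled k₁ k₂ k₃ a b c → Labeled k₁ k₂ k₃ a′ b′ c′
  labeled-resp a≈ b≈ c≈ (base a≈x₁ b≈x₂ c≈x₃) = base
    (λ m → trans (sym (a≈ m)) (a≈x₁ m)) (λ m → trans (sym (b≈ m)) (b≈x₂ m)) (λ m → trans (sym (c≈ m)) (c≈x₃ m))
  labeled-resp {a} {b} {c} {a′} {b′} {c′} a≈ b≈ c≈ (mut₁ {a = x} L eq) =
    mut₁ {a = x} (labeled-resp (λ _ → refl) b≈ c≈ L) (Exchange.equation
      (exchange-cong {κ k₁} {x} {a} {b} {c} {x} {a′} {b′} {c′} (λ _ → refl) a≈ b≈ c≈ (holds eq)))
  labeled-resp {a} {b} {c} {a′} {b′} {c′} a≈ b≈ c≈ (mut₂ {b = y} L eq) =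
    mut₂ {b = y} (labeled-resp a≈ (λ _ → refl) c≈ L) (Exchange.equation
      (exchange-cong {κ k₂} {y} {b} {a} {c} {y} {b′} {a′} {c′} (λ _ → refl) b≈ a≈ c≈ (holds eq)))
  labeled-resp {a} {b} {c} {a′} {b′} {c′} a≈ b≈ c≈ (mut₃ {c = z} L eq) =
    mut₃ {c = z} (labeled-resp a≈ b≈ (λ _ → refl) L) (Exchange.equation
      (exchange-cong {κ k₃} {z} {c} {a} {b} {z} {c′} {a′} {b′} (λ _ → refl) c≈ a≈ b≈ (holds eq)))

  labeled : ∀ {a b c} → LabeledCluster k₁ k₂ k₃ a b c → Labeled k₁ k₂ k₃ a b c
  labeled (_ , _ , _ , L , a≈ , b≈ , c≈) =
    labeled-resp (λ m → sym (a≈ m)) (λ m → sym (b≈ m)) (λ m → sym (c≈ m)) L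

  -- The subscripts are the positions of a, b and c in the labeled cluster.
  data Seed : (k l n : ℕ) (a b c : Laurent) → Set where
    seed₁₂₃ : ∀ {a b c} → Labeled k₁ k₂ k₃ a b c → Seed k₁ k₂ k₃ a b c
    seed₁₃₂ : ∀ {a b c} → Labeled k₁ k₂ k₃ a c b → Seed k₁ k₃ k₂ a b c
    seed₂₁₃ : ∀ {a b c} → Labeled k₁ k₂ k₃ b a c → Seed k₂ k₁ k₃ a b c
    seed₃₁₂ : ∀ {a b c} → Labeled k₁ k₂ k₃ b c a → Seed k₃ k₁ k₂ a b c
    seed₂₃₁ : ∀ {a b c} → Labeled k₁ k₂ k₃ c a b → Seed k₂ k₃ k₁ a b c
    seed₃₂₁ : ∀ {a b c} → Labeled k₁ k₂ k₃ c b a → Seed k₃ k₂ k₁ a b c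

  cluster⇒seed : ∀ {a b c} → NonLabeledCluster k₁ k₂ k₃ a b c → ∃[ k ] ∃[ l ] ∃[ n ] Seed k l n a b c
  cluster⇒seed (inj₁ abc) = _ , _ , _ , seed₁₂₃ (labeled abc)
  cluster⇒seed (inj₂ (inj₁ acb)) = _ , _ , _ , seed₁₃₂ (labeled acb)
  cluster⇒seed (inj₂ (inj₂ (inj₁ bac))) = _ , _ , _ , seed₂₁₃ (labeled bac)
  cluster⇒seed (inj₂ (inj₂ (inj₂ (inj₁ bca)))) = _ , _ , _ , seed₃₁₂ (labeled bca)
  cluster⇒seed (inj₂ (inj₂ (inj₂ (inj₂ (inj₁ cab))))) = _ , _ , _ , seed₂₃₁ (labeled cab)
  cluster⇒seed (inj₂ (inj₂ (inj₂ (inj₂ (inj₂ cba))))) = _ , _ , _ , seed₃₂₁ (labeled cba)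

  seed⇒cluster : ∀ {x y z k l n a b c} → x ≈ a → y ≈ b → z ≈ c →
    Seed k l n a b c → NonLabeledCluster k₁ k₂ k₃ x y z
  seed⇒cluster x≈a y≈b z≈c (seed₁₂₃ L) = inj₁ (_ , _ , _ , L , x≈a , y≈b , z≈c)
  seed⇒cluster x≈a y≈b z≈c (seed₁₃₂ L) = inj₂ (inj₁ (_ , _ , _ , L , x≈a , z≈c , y≈b))
  seed⇒cluster x≈a y≈b z≈c (seed₂₁₃ L) = inj₂ (inj₂ (inj₁ (_ , _ , _ , L , y≈b , x≈a , z≈c)))
  seed⇒cluster x≈a y≈b z≈c (seed₃₁₂ L) = inj₂ (inj₂ (inj₂ (inj₁ (_ , _ , _ , L , y≈b , z≈c , x≈a))))
  seed⇒cluster x≈a y≈b z≈c (seed₂₃₁ L) = inj₂ (inj₂ (inj₂ (inj₂ (inj₁ (_ , _ , _ , L , z≈c , x≈a , y≈b)))))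
  seed⇒cluster x≈a y≈b z≈c (seed₃₂₁ L) = inj₂ (inj₂ (inj₂ (inj₂ (inj₂ (_ , _ , _ , L , z≈c , y≈b , x≈a)))))

  seed-parity : ∀ {k l n a b c} → Seed k l n a b c → Parity k₁ k₂ k₃ b l
  seed-parity (seed₁₂₃ L) = pos₂ L λ _ → refl
  seed-parity (seed₁₃₂ L) = pos₃ L λ _ → refl
  seed-parity (seed₂₁₃ L) = pos₁ L λ _ → refl
  seed-parity (seed₃₁₂ L) = pos₁ L λ _ → refl
  seed-parity (seed₂₃₁ L) = pos₃ L λ _ → refl
  seed-parity (seed₃₂₁ L) = pos₂ L λ _ → refl

  seed-chart : ∀ {k l n a b c} → Seed k l n a b c → Chart k l n a b c
  seed-chart (seed₁₂₃ L) = chart-labeled L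
  seed-chart (seed₁₃₂ L) = chart-swap₂₃ (chart-labeled L)
  seed-chart (seed₂₁₃ L) = chart-swap₁₂ (chart-labeled L)
  seed-chart (seed₃₁₂ L) = chart-swap₁₂ (chart-swap₂₃ (chart-labeled L))
  seed-chart (seed₂₃₁ L) = chart-swap₂₃ (chart-swap₁₂ (chart-labeled L))
  seed-chart (seed₃₂₁ L) = chart-swap₁₂ (chart-swap₂₃ (chart-swap₁₂ (chart-labeled L)))

  seed-mutate : ∀ {k l n a b y c} → Exchange (κ l) b y a c → Seed k l n a b c → Seed k l n a y c
  seed-mutate (holds eq) (seed₁₂₃ L) = seed₁₂₃ (mut₂ L eq)
  seed-mutate (holds eq) (seed₁₃₂ L) = seed₁₃₂ (mut₃ L eq)
  seed-mutate (holds eq) (seed₂₁₃ L) = seed₂₁₃ (mut₁ L eq)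
  seed-mutate ex (seed₃₁₂ L) = seed₃₁₂ (mut₁ L (Exchange.equation (exchange-comm ex)))
  seed-mutate ex (seed₂₃₁ L) = seed₂₃₁ (mut₃ L (Exchange.equation (exchange-comm ex)))
  seed-mutate ex (seed₃₂₁ L) = seed₃₂₁ (mut₂ L (Exchange.equation (exchange-comm ex)))

  cluster-mutate : ∀ {a b c y k l n} → NonLabeledCluster k₁ k₂ k₃ a b c →
    Markov (𝓜 k₁ k₂ k₃) (κ k) (κ l) (κ n) a b c → Exchange (κ l) b y a c → ∃[ k ] ∃[ n ] Seed k l n a y c
  cluster-mutate {a} {b} {c} {y} {l = l} cluster markov exchange =
    let k′ , l′ , n′ , seed = cluster⇒seed {a} {b} {c} cluster
        l′≡l = chart-middle (seed-chart seed) markov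
    in k′ , n′ , subst (λ l → Seed k′ l n′ a y c) l′≡l
         (seed-mutate (subst (λ l → Exchange (κ l) b y a c) (sym l′≡l) exchange) seed)

open Monodromy laurentRing using (_#_; matrix; det≈1; module Decomposition)

toMat₂ : Mat → Mat₂ Laurent
toMat₂ A = mat₂ (m₁₁ A) (m₁₂ A) (m₂₁ A) (m₂₂ A)

fromMat₂ : Mat₂ Laurent → Mat
fromMat₂ A = mat (e₁₁ A) (e₁₂ A) (e₂₁ A) (e₂₂ A)

theorem6p13 : (k₁ k₂ k₃ : ℕ) (P Q R : Mat) (a b c : Laurent) →
    CGCTriple k₁ k₂ k₃ P Q R a b c →
    (∣ a ∣ ⊔ ∣ c ∣) < ∣ b ∣ →
    Σ Mat (λ X → Σ Mat (λ Y → Σ Mat (λ Z →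
      MMDecomposition k₁ k₂ k₃ P Q R a b c X Y Z ×
      ((X' Y' Z' : Mat) → MMDecomposition k₁ k₂ k₃ P Q R a b c X' Y' Z' →
        X' ≈M X × Y' ≈M Y × Z' ≈M Z))))
theorem6p13 k₁ k₂ k₃ P Q R a b c
  ( (detP , k , parityP , trP) , (detQ , l , parityQ , trQ) , (detR , n , parityR , trR)
  , Q≈PR⊖S , P₁₂≈a , Q₁₂≈b , R₁₂≈c , cluster) _ =
  fromMat₂ (matrix X) , fromMat₂ (matrix Y) , fromMat₂ (matrix Z) ,
  ( isCMMTriple , P≈-[YZ]⁻¹ , Q≈-[XZ]⁻¹ , R≈-[XY]⁻¹
  , (k , parity-a , tr-X) , (l , parity-resp Q₁₂≈b parityQ , tr-Y) , (n , parity-c , tr-Z)) ,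
  λ X′ Y′ Z′ ( ((detX′ , _) , (detY′ , _) , (detZ′ , _) , X′Y′Z′≈T , _) , P≈ , Q≈ , R≈ , _) →
    unique (toMat₂ X′ # detX′) (toMat₂ Y′ # detY′) (toMat₂ Z′ # detZ′) X′Y′Z′≈T P≈ Q≈ R≈
  where
  open Clusters k₁ k₂ k₃
  open Decomposition {𝓜 k₁ k₂ k₃} {κ k} {κ l} {κ n} {a} {b} {c}
    (toMat₂ P # detP) (toMat₂ Q # detQ) (toMat₂ R # detR) Q≈PR⊖S P₁₂≈a Q₁₂≈b R₁₂≈c trP trQ trR
  parity-a : Parity k₁ k₂ k₃ a k
  parity-a = parity-resp P₁₂≈a parityP
  parity-c : Parity k₁ k₂ k₃ c n
  parity-c = parity-resp R₁₂≈c parityR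
  mutated : ∃[ k′ ] ∃[ n′ ] Seed k′ l n′ a (e₁₂ (matrix Y)) c
  mutated = cluster-mutate {a} {b} {c} cluster markov exchange
  seed : Seed (proj₁ mutated) l (proj₁ (proj₂ mutated)) a (e₁₂ (matrix Y)) c
  seed = proj₂ (proj₂ mutated)
  isCMMTriple : CMMTriple k₁ k₂ k₃ (fromMat₂ (matrix X)) (fromMat₂ (matrix Y)) (fromMat₂ (matrix Z))
  isCMMTriple =
      (det≈1 X , k , parity-resp (λ m → sym (X₁₂≈a m)) parity-a , tr-X)
    , (det≈1 Y , l , seed-parity seed , tr-Y)
    , (det≈1 Z , n , parity-resp (λ m → sym (Z₁₂≈c m)) parity-c , tr-Z)
    , XYZ≈T
    , seed⇒cluster {e₁₂ (matrix X)} {e₁₂ (matrix Y)} {e₁₂ (matrix Z)} X₁₂≈a (λ _ → refl) Z₁₂≈c seed
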